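{- There are precisely $2272$ distinct sequences $a\colon \mathbb{N}_0\to\{+1,-1\}$ which are binary pattern counting sequences of length $\leq 4$ and are noncorrelated.
   Context: Work in base $k=2$ with digit alphabet $\Sigma_2=\{\mathtt 0,\mathtt 1\}$; $\Sigma_2^*$ denotes the set of finite words over $\Sigma_2$ (including the empty word), and for $n\in\mathbb{N}_0$, $(n)_2$ is the binary expansion of $n$ without leading zeros. For a word $v$ that is not of the form $\mathtt 0^j$ ($j\ge 0$) and $n\in\mathbb{N}_0$, $\#(v,n)$ is the number of pairs of words $(x,y)$ with $\mathtt 0^{|v|-1}(n)_2 = xvy$ (occurrences counted with overlaps). A set $A\subset\Sigma_2^*$ is admissible if it is finite and contains no word of the form $\mathtt 0^j$; then $a_A(n)=(-1)^{\sum_{v\in A}\#(v,n)}$. A binary pattern counting sequence of length $\leq \ell$ is a sequence of the form $a_A$ for some admissible $A$ all of whose words have length $\leq \ell$. For $a\colon\mathbb{N}_0\to\mathbb{C}$ and $m\in\mathbb{N}_0$, $\gamma_a(m)=\lim_{N\to\infty}\frac1N\sum_{n=0}^{N-1}a(n)\overline{a(n+m)}$; $a$ is noncorrelated if $\gamma_a(m)$ exists and equals $0$ for every $m\geq 1$. -}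

module Defs where

open import Data.Nat as ℕ using (ℕ; zero; suc; _≤_; _/_; _%_)
open import Data.Integer as ℤ using (ℤ; +_; -[1+_])
open import Data.Rational as ℚ using (ℚ; 0ℚ)
open import Data.Fin using (Fin; zero; suc)
open import Data.Fin.Properties using () renaming (_≟_ to _≟ᶠ_)
open import Data.Bool using (Bool; true; false; _∧_)
open import Data.List using (List; []; _∷_; length; reverse; replicate; _++_)
open import Data.List.Relation.Unary.All using (All)
open import Data.List.Relation.Unary.Any using (Any)
open import Data.List.Relation.Unary.Unique.Propositional using (Unique)
open import Data.Product using (Σ; ∃; _×_)
open import Relation.Nullary using (¬_; does)
open import Relation.Binary.PropositionalEquality using (_≡_)

Digit : Set
Digit = Fin 2

Word : Set
Word = List Digit

bit : ℕ → Digit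
bit n with n % 2
... | zero = zero
... | suc _ = suc zero

-- least-significant-first binary digits of n, with fuel (fuel n suffices)
bitsLE : (fuel n : ℕ) → Word
bitsLE zero    _       = []
bitsLE (suc f) zero    = []
bitsLE (suc f) (suc m) = bit (suc m) ∷ bitsLE f (suc m / 2)

-- (n)_2 : binary expansion, most significant digit first, no leading zeros;
-- (0)_2 is the empty word.
binary : ℕ → Word
binary n = reverse (bitsLE n n)

isPrefix : Word → Word → Bool
isPrefix []      _       = true
isPrefix (_ ∷ _) []      = false
isPrefix (c ∷ v) (d ∷ w) = does (c ≟ᶠ d) ∧ isPrefix v w

ind : Bool → ℕ
ind true  = 1
ind false = 0

occ : Word → Word → ℕ
occ v []      = ind (isPrefix v [])
occ v (c ∷ w) = ind (isPrefix v (c ∷ w)) ℕ.+ occ v w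

count# : Word → ℕ → ℕ
count# v n = occ v (replicate (length v ℕ.∸ 1) zero ++ binary n)

-- a word is not of the form 0^j  iff  it contains the digit 1
NotZeros : Word → Set
NotZeros v = Any (λ c → c ≡ suc zero) v

-- a finite set of words, represented as a duplicate-free list
Admissible : List Word → Set
Admissible A = Unique A × All NotZeros A

totalCount : List Word → ℕ → ℕ
totalCount []      n = 0
totalCount (v ∷ A) n = count# v n ℕ.+ totalCount A n

patternSeq : List Word → ℕ → ℤ
patternSeq A n = (ℤ.- (+ 1)) ℤ.^ totalCount A n

IsBPCS : ℕ → (ℕ → ℤ) → Set
IsBPCS ℓ a = Σ (List Word) λ A →
  Admissible A × All (λ v → length v ≤ ℓ) A × (∀ n → a n ≡ patternSeq A n)

-- Σ_{n<N} a(n) * a(n+m)   (sequences are real/integer valued, conjugation trivial)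
corrSum : (ℕ → ℤ) → ℕ → ℕ → ℤ
corrSum a m zero    = + 0
corrSum a m (suc N) = corrSum a m N ℤ.+ a N ℤ.* a (N ℕ.+ m)

-- (1/N) Σ_{n<N} a(n) a(n+m) → 0 as N → ∞  (N ranges over N ≥ 1, written suc N)
CorrToZero : (ℕ → ℤ) → ℕ → Set
CorrToZero a m = ∀ (ε : ℚ) → 0ℚ ℚ.< ε →
  ∃ λ N₀ → ∀ N → N₀ ≤ N → ℚ.∣ corrSum a m (suc N) ℚ./ suc N ∣ ℚ.< ε

Noncorrelated : (ℕ → ℤ) → Set
Noncorrelated a = ∀ m → 1 ≤ m → CorrToZero a m

_≗ˢ_ : (ℕ → ℤ) → (ℕ → ℤ) → Set
f ≗ˢ g = ∀ n → f n ≡ g n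

{-# OPTIONS --safe #-}

-- A pattern counting sequence of length ≤ 4 satisfies a(0) = 1 and a(x) = a(⌊x/2⌋) G(x), where the sign G(x) depends
-- only on x mod 16 and G(0) = 1; the 2¹⁵ choices of G give pairwise distinct sequences.
--
-- For a weight w of period 8 put S(w,m,N) = Σ_{n<N} w(n) a(n) a(n+m).  Splitting n by parity gives
-- S(w,m,2N) = S(w₀,⌊m/2⌋,N) + S(w₁,⌈m/2⌉,N) for weights w₀, w₁ computed from w, G and m.  Hence S(w,m,N)/N converges to
-- a linear function of (w(0),…,w(7)), represented by a profile V_m ∈ ℤ⁸: V₀ is constant, V₁ solves a linear
-- equation, and V_m is determined by V_⌊m/2⌋ and V_⌈m/2⌉ for m ≥ 2.  The sequence is noncorrelated iff the
-- entries of each V_m, m ≥ 1, sum to 0.  Going through the 2¹⁵ kernels shows that if this holds for m = 1, 2, 3, 4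
-- then V₄ = V₅ = V₆ = V₇ = 0, hence V_m = 0 for all m ≥ 4; it holds for exactly 2272 kernels.
module Submission where

open import Defs
open import Data.Bool as Bool using (Bool; true; false; _∧_; not)
open import Data.Bool.Properties using (∧-zeroʳ; ∧-identityʳ)
open import Data.Fin using (zero; suc)
open import Data.Fin.Properties using () renaming (_≟_ to _≟ᶠ_)
open import Data.Integer as ℤ using (ℤ; +_; -[1+_]; ∣_∣)
import Data.Integer.Properties as ℤₚ
import Data.Integer.Tactic.RingSolver as ℤ-Solver
open import Data.List using (List; []; _∷_; length; reverse; replicate; _++_; _∷ʳ_; map; filter; foldr)
import Data.List.Properties as Listₚ
open import Data.List.Membership.Propositional using (_∈_)
import Data.List.Membership.Propositional.Properties as ∈ₚ
open import Data.List.Relation.Binary.Sublist.Propositional using (_⊆_; []; _∷_) renaming (_∷ʳ_ to _∷ˢ_)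
open import Data.List.Relation.Binary.Sublist.Propositional.Properties using (All-resp-⊆)
open import Data.List.Relation.Unary.All as All using (All; []; _∷_)
import Data.List.Relation.Unary.All.Properties as Allₚ
open import Data.List.Relation.Unary.AllPairs as AllPairs using (AllPairs; []; _∷_)
import Data.List.Relation.Unary.AllPairs.Properties as AllPairsₚ
open import Data.List.Relation.Unary.Any as Any using (Any; here; there)
import Data.List.Relation.Unary.Any.Properties as Anyₚ
import Data.List.Relation.Unary.Unique.DecPropositional as DecUnique
open import Data.List.Relation.Unary.Unique.Propositional using (Unique)
import Data.List.Relation.Unary.Unique.Propositional.Properties as Uniqueₚ
open import Data.Maybe as Maybe using (Maybe; just; nothing)
open import Data.Nat as ℕ using (ℕ; zero; suc; _/_; _%_; _≤_; _<_; z≤n; s≤s; _+_; _*_; _∸_; _^_; _≡ᵇ_)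
open import Data.Nat.Divisibility using (m∣m*n)
import Data.Nat.DivMod as ℕᵈ
open import Data.Nat.Induction using (<-rec)
import Data.Nat.Properties as ℕₚ
import Data.Nat.Tactic.RingSolver as ℕ-Solver
open import Data.Product using (Σ; ∃; _×_; _,_; proj₁; proj₂)
open import Data.Rational as ℚ using (0ℚ; ↧ₙ_)
import Data.Rational.Properties as ℚₚ
import Data.Rational.Unnormalised as ℚᵘ
import Data.Rational.Unnormalised.Properties as ℚᵘₚ
open import Data.Sum using (_⊎_; inj₁; inj₂)
open import Data.Vec as Vec using (Vec; []; _∷_)
import Data.Vec.Properties as Vecₚ
open import Function using (_∘_; mk⇔)
open import Relation.Binary.PropositionalEquality
open import Relation.Nullary using (¬_; Dec; yes; no; does; contradiction; _×-dec_)
open import Relation.Nullary.Decidable using (from-yes; does-⇔; decidable-stable)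

-- Weights enter because halving attaches the sign `κ G m`, of period 16, to each product; sampled
-- at the even or at the odd numbers it has period 8, so bounded weights of period 8 are stable
-- under splitting. Integrality is arranged by scaling: a profile comes with a factor `D`, and 24 =
-- 2³ · 3 as the profile of the shift 0 clears all denominators of V₁. Three successive halvings
-- account for 2³; the only entry that refers to itself, at the residue 7, contributes the divisor 2
-- - `k 15`, which is 1 or 3. The obstacle beyond small shifts is that a zero sum is not inherited:
-- it concerns only the constant weight, while the profile of m is assembled from those of its
-- halves with other weights. A zero profile is inherited, which is why the finite check asks V₄,
-- ..., V₇ to vanish rather than merely to have sum 0.

0ᶻ 1ᶻ : ℤ
0ᶻ = + 0
1ᶻ = + 1

-- Parity and finite sums.

data Halves : ℕ → Set where
  even : ∀ n → Halves (n * 2)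
  odd  : ∀ n → Halves (suc (n * 2))

halves : ∀ n → Halves n
halves zero = even 0
halves (suc n) with halves n
... | even m = odd m
... | odd m  = even (suc m)

even/2 : ∀ n → n * 2 / 2 ≡ n
even/2 n = ℕᵈ.m*n/n≡m n 2

odd/2 : ∀ n → suc (n * 2) / 2 ≡ n
odd/2 zero = refl
odd/2 (suc n) = trans (ℕᵈ.m/n≡1+[m∸n]/n {suc (suc n * 2)} {2} (s≤s (s≤s z≤n))) (cong suc (odd/2 n))

n≤n*2 : ∀ n → n ≤ n * 2
n≤n*2 n = ℕₚ.m≤m*n n 2

∑ : ℕ → (ℕ → ℤ) → ℤ
∑ zero    f = 0ᶻ
∑ (suc N) f = ∑ N f ℤ.+ f N

∑-cong< : ∀ N {f g : ℕ → ℤ} → (∀ n → n < N → f n ≡ g n) → ∑ N f ≡ ∑ N g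
∑-cong< zero    f≗g = refl
∑-cong< (suc N) f≗g = cong₂ ℤ._+_ (∑-cong< N λ n n<N → f≗g n (ℕₚ.m<n⇒m<1+n n<N)) (f≗g N (ℕₚ.n<1+n N))

∑-cong : ∀ N {f g : ℕ → ℤ} → (∀ n → f n ≡ g n) → ∑ N f ≡ ∑ N g
∑-cong N f≗g = ∑-cong< N λ n _ → f≗g n

∑-distrib-+ : ∀ N (f g : ℕ → ℤ) → ∑ N (λ n → f n ℤ.+ g n) ≡ ∑ N f ℤ.+ ∑ N g
∑-distrib-+ zero    f g = refl
∑-distrib-+ (suc N) f g = trans (cong (ℤ._+ (f N ℤ.+ g N)) (∑-distrib-+ N f g)) (swap (∑ N f) (∑ N g) (f N) (g N))
  where
  swap : ∀ x y z t → x ℤ.+ y ℤ.+ (z ℤ.+ t) ≡ x ℤ.+ z ℤ.+ (y ℤ.+ t)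
  swap = ℤ-Solver.solve-∀

*-distribˡ-∑ : ∀ c N (f : ℕ → ℤ) → c ℤ.* ∑ N f ≡ ∑ N (λ n → c ℤ.* f n)
*-distribˡ-∑ c zero    f = ℤₚ.*-zeroʳ c
*-distribˡ-∑ c (suc N) f = trans (ℤₚ.*-distribˡ-+ c (∑ N f) (f N)) (cong (ℤ._+ c ℤ.* f N) (*-distribˡ-∑ c N f))

∑-split : ∀ m N (f : ℕ → ℤ) → ∑ (m + N) f ≡ ∑ m f ℤ.+ ∑ N (λ n → f (m + n))
∑-split m zero    f = trans (cong (λ k → ∑ k f) (ℕₚ.+-identityʳ m)) (sym (ℤₚ.+-identityʳ _))
∑-split m (suc N) f = begin
  ∑ (m + suc N) f                                   ≡⟨ cong (λ k → ∑ k f) (ℕₚ.+-suc m N) ⟩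
  ∑ (m + N) f ℤ.+ f (m + N)                         ≡⟨ cong (ℤ._+ f (m + N)) (∑-split m N f) ⟩
  ∑ m f ℤ.+ ∑ N (λ n → f (m + n)) ℤ.+ f (m + N)     ≡⟨ ℤₚ.+-assoc (∑ m f) _ _ ⟩
  ∑ m f ℤ.+ ∑ (suc N) (λ n → f (m + n))             ∎
  where open ≡-Reasoning

∑-pairs : ∀ N (f : ℕ → ℤ) → ∑ (N * 2) f ≡ ∑ N (λ n → f (n * 2) ℤ.+ f (suc (n * 2)))
∑-pairs zero    f = refl
∑-pairs (suc N) f = trans (ℤₚ.+-assoc (∑ (N * 2) f) _ _) (cong (ℤ._+ (f (N * 2) ℤ.+ f (suc (N * 2)))) (∑-pairs N f))

∣i∣≤1⇒∣i*j∣≤∣j∣ : ∀ i j → ∣ i ∣ ≤ 1 → ∣ i ℤ.* j ∣ ≤ ∣ j ∣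
∣i∣≤1⇒∣i*j∣≤∣j∣ i j i≤1 = begin
  ∣ i ℤ.* j ∣     ≡⟨ ℤₚ.abs-* i j ⟩
  ∣ i ∣ * ∣ j ∣   ≤⟨ ℕₚ.*-monoˡ-≤ ∣ j ∣ i≤1 ⟩
  1 * ∣ j ∣       ≡⟨ ℕₚ.*-identityˡ ∣ j ∣ ⟩
  ∣ j ∣           ∎
  where open ℕₚ.≤-Reasoning

-- Profiles and their pairing with weights.

norm : ℕ → (ℕ → ℤ) → ℕ
norm zero    V = 0
norm (suc N) V = norm N V + ∣ V N ∣

interleave : (X Y : ℕ → ℤ) → ℕ → ℤ
interleave X Y zero          = X 0
interleave X Y (suc zero)    = Y 0
interleave X Y (suc (suc x)) = interleave (X ∘ suc) (Y ∘ suc) x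

interleave-even : ∀ X Y n → interleave X Y (n * 2) ≡ X n
interleave-even X Y zero    = refl
interleave-even X Y (suc n) = interleave-even (X ∘ suc) (Y ∘ suc) n

interleave-odd : ∀ X Y n → interleave X Y (suc (n * 2)) ≡ Y n
interleave-odd X Y zero    = refl
interleave-odd X Y (suc n) = interleave-odd (X ∘ suc) (Y ∘ suc) n

interleave-* : ∀ c X Y n → interleave (λ r → c ℤ.* X r) (λ r → c ℤ.* Y r) n ≡ c ℤ.* interleave X Y n
interleave-* c X Y zero = refl
interleave-* c X Y (suc zero) = refl
interleave-* c X Y (suc (suc n)) = interleave-* c (X ∘ suc) (Y ∘ suc) n

-- The sign relating `a x * a (x + m)` to the product of `a` at the two halved arguments.
κ : (ℕ → ℤ) → ℕ → ℕ → ℤ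
κ G m x = G x ℤ.* G (x + m)

-- If X and Y are the profiles of the shifts ⌊m/2⌋ and ⌈m/2⌉, then fold (κ G m) X Y is twice the profile of m.
fold : (k X Y : ℕ → ℤ) → ℕ → ℤ
fold k X Y r = k r ℤ.* interleave X Y r ℤ.+ k (8 + r) ℤ.* interleave X Y (8 + r)

record IsWeight (w : ℕ → ℤ) : Set where
  field
    periodic : ∀ n → w (8 + n) ≡ w n
    bounded  : ∀ n → ∣ w n ∣ ≤ 1

dot : (w V : ℕ → ℤ) → ℤ
dot w V = ∑ 8 (λ r → w r ℤ.* V r)

∣dot∣≤norm : ∀ {w} V → IsWeight w → ∣ dot w V ∣ ≤ norm 8 V
∣dot∣≤norm {w} V isW = go 8
  where
  go : ∀ N → ∣ ∑ N (λ r → w r ℤ.* V r) ∣ ≤ norm N V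
  go zero    = z≤n
  go (suc N) = ℕₚ.≤-trans (ℤₚ.∣i+j∣≤∣i∣+∣j∣ (∑ N _) _)
    (ℕₚ.+-mono-≤ (go N) (∣i∣≤1⇒∣i*j∣≤∣j∣ (w N) (V N) (IsWeight.bounded isW N)))

evens odds : (k w : ℕ → ℤ) → ℕ → ℤ
evens k w n = w (n * 2) ℤ.* k (n * 2)
odds  k w n = w (suc (n * 2)) ℤ.* k (suc (n * 2))

-- `fold` is the adjoint of splitting a weight. Both sides are one sum over 16 residues: grouping
-- `r` with `8 + r` gives the left side by periodicity of `w`, grouping `n * 2` with its successor
-- gives the right side.
dot-fold : ∀ k X Y w → (∀ n → w (8 + n) ≡ w n) →
           dot w (fold k X Y) ≡ dot (evens k w) X ℤ.+ dot (odds k w) Y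
dot-fold k X Y w per = begin
  dot w (fold k X Y)                              ≡⟨ ∑-cong 8 distribute ⟩
  ∑ 8 (λ r → h r ℤ.+ h (8 + r))                   ≡⟨ ∑-distrib-+ 8 h (λ r → h (8 + r)) ⟩
  ∑ 8 h ℤ.+ ∑ 8 (λ r → h (8 + r))                 ≡⟨ ∑-split 8 8 h ⟨
  ∑ 16 h                                          ≡⟨ ∑-pairs 8 h ⟩
  ∑ 8 (λ n → h (n * 2) ℤ.+ h (suc (n * 2)))       ≡⟨ ∑-cong 8 separate ⟩
  ∑ 8 (λ n → evens k w n ℤ.* X n ℤ.+ odds k w n ℤ.* Y n)
    ≡⟨ ∑-distrib-+ 8 (λ n → evens k w n ℤ.* X n) (λ n → odds k w n ℤ.* Y n) ⟩
  dot (evens k w) X ℤ.+ dot (odds k w) Y          ∎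
  where
  open ≡-Reasoning
  z h : ℕ → ℤ
  z = interleave X Y
  h x = w x ℤ.* (k x ℤ.* z x)
  distribute : ∀ r → w r ℤ.* fold k X Y r ≡ h r ℤ.+ h (8 + r)
  distribute r = trans (ℤₚ.*-distribˡ-+ (w r) (k r ℤ.* z r) (k (8 + r) ℤ.* z (8 + r)))
                       (cong (λ t → h r ℤ.+ t ℤ.* (k (8 + r) ℤ.* z (8 + r))) (sym (per r)))
  split-at : ∀ x {v} → z x ≡ v → h x ≡ w x ℤ.* k x ℤ.* v
  split-at x refl = sym (ℤₚ.*-assoc (w x) (k x) (z x))
  separate : ∀ n → h (n * 2) ℤ.+ h (suc (n * 2)) ≡ evens k w n ℤ.* X n ℤ.+ odds k w n ℤ.* Y n
  separate n = cong₂ ℤ._+_ (split-at (n * 2) (interleave-even X Y n)) (split-at (suc (n * 2)) (interleave-odd X Y n))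

-- Signs, kernels and generated sequences.

IsSign : ℤ → Set
IsSign i = i ≡ 1ᶻ ⊎ i ≡ ℤ.- 1ᶻ

sign-* : ∀ {i j} → IsSign i → IsSign j → IsSign (i ℤ.* j)
sign-* (inj₁ refl) (inj₁ refl) = inj₁ refl
sign-* (inj₁ refl) (inj₂ refl) = inj₂ refl
sign-* (inj₂ refl) (inj₁ refl) = inj₂ refl
sign-* (inj₂ refl) (inj₂ refl) = inj₁ refl

sign²≡1 : ∀ {i} → IsSign i → i ℤ.* i ≡ 1ᶻ
sign²≡1 (inj₁ refl) = refl
sign²≡1 (inj₂ refl) = refl

∣sign∣≤1 : ∀ {i} → IsSign i → ∣ i ∣ ≤ 1
∣sign∣≤1 (inj₁ refl) = s≤s z≤n
∣sign∣≤1 (inj₂ refl) = s≤s z≤n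

record IsKernel (G : ℕ → ℤ) : Set where
  field
    sign     : ∀ x → IsSign (G x)
    periodic : ∀ x → G (16 + x) ≡ G x

record Generates (G a : ℕ → ℤ) : Set where
  field
    base : a 0 ≡ 1ᶻ
    step : ∀ x → a x ≡ a (x / 2) ℤ.* G x

-- Smallness in ℚ as inequalities in ℕ.

∣/∣≃ : ∀ i N → ℚ.toℚᵘ ℚ.∣ i ℚ./ suc N ∣ ℚᵘ.≃ ℚᵘ.mkℚᵘ (+ ∣ i ∣) N
∣/∣≃ i N = ℚᵘₚ.≃-trans (ℚₚ.toℚᵘ-homo-∣-∣ (i ℚ./ suc N)) (ℚᵘₚ.∣-∣-cong (ℚₚ.toℚᵘ-fromℚᵘ (ℚᵘ.mkℚᵘ i N)))

-- A positive rational is at least the reciprocal of its denominator, so only `↧ₙ ε` matters.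
small⇒∣/∣<ε : ∀ i N ε → 0ℚ ℚ.< ε → ↧ₙ ε * ∣ i ∣ < suc N → ℚ.∣ i ℚ./ suc N ∣ ℚ.< ε
small⇒∣/∣<ε i N (ℚ.mkℚ (+ zero)   d _) (ℚ.*<* (ℤ.+<+ ())) _
small⇒∣/∣<ε i N (ℚ.mkℚ -[1+ _ ]   d _) (ℚ.*<* ()) _
small⇒∣/∣<ε i N ε@(ℚ.mkℚ (+ suc p) d _) _ d*∣i∣<N =
  ℚₚ.toℚᵘ-cancel-< (ℚᵘₚ.<-respˡ-≃ (ℚᵘₚ.≃-sym (∣/∣≃ i N)) (ℚᵘ.*<* (subst₂ ℤ._<_ (ℤₚ.pos-* ∣ i ∣ (suc d)) (ℤₚ.pos-* (suc p) (suc N)) (ℤ.+<+ (begin-strict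
    ∣ i ∣ * suc d     ≡⟨ ℕₚ.*-comm ∣ i ∣ (suc d) ⟩
    suc d * ∣ i ∣     <⟨ d*∣i∣<N ⟩
    suc N             ≤⟨ ℕₚ.m≤n*m (suc N) (suc p) ⟩
    suc p * suc N     ∎)))))
  where open ℕₚ.≤-Reasoning

∣/∣<1/d⇒small : ∀ i N d → ℚ.∣ i ℚ./ suc N ∣ ℚ.< + 1 ℚ./ suc d → suc d * ∣ i ∣ < suc N
∣/∣<1/d⇒small i N d lt with ℚᵘₚ.<-respˡ-≃ (∣/∣≃ i N) (ℚᵘₚ.<-respʳ-≃ (ℚₚ.toℚᵘ-fromℚᵘ (ℚᵘ.mkℚᵘ (+ 1) d)) (ℚₚ.toℚᵘ-mono-< lt))
... | ℚᵘ.*<* ∣i∣*d<1*N = subst₂ _<_ (ℕₚ.*-comm ∣ i ∣ (suc d)) (ℕₚ.*-identityˡ (suc N))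
  (ℤₚ.drop‿+<+ (subst₂ ℤ._<_ (sym (ℤₚ.pos-* ∣ i ∣ (suc d))) (sym (ℤₚ.pos-* 1 (suc N))) ∣i∣*d<1*N))

0<1/d : ∀ d → 0ℚ ℚ.< + 1 ℚ./ suc d
0<1/d d = ℚₚ.toℚᵘ-cancel-< (ℚᵘₚ.<-respʳ-≃ (ℚᵘₚ.≃-sym (ℚₚ.toℚᵘ-fromℚᵘ (ℚᵘ.mkℚᵘ (+ 1) d))) (ℚᵘ.*<* (ℤ.+<+ (s≤s z≤n))))

-- Weighted correlations and their asymptotic profiles.

constant : ∀ z → IsSign z → IsWeight (λ _ → z)
constant z σ = record { periodic = λ _ → refl ; bounded = λ _ → ∣sign∣≤1 σ }

module Correlation {G a : ℕ → ℤ} (isKernel : IsKernel G) (generates : Generates G a) where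
  open Generates generates
  private module K = IsKernel isKernel

  a-sign : ∀ x → IsSign (a x)
  a-sign = <-rec _ go
    where
    go : ∀ x → (∀ {y} → y < x → IsSign (a y)) → IsSign (a x)
    go zero    _  = inj₁ base
    go (suc x) ih = subst IsSign (sym (step (suc x)))
      (sign-* (ih (ℕᵈ.m/n<m (suc x) 2 (s≤s (s≤s z≤n)))) (K.sign (suc x)))

  c : ℕ → ℕ → ℤ
  c m n = a n ℤ.* a (n + m)

  c-sign : ∀ m n → IsSign (c m n)
  c-sign m n = sign-* (a-sign n) (a-sign (n + m))

  k : ℕ → ℕ → ℤ
  k = κ G

  record Splits (m lo hi : ℕ) : Set where
    field
      at-even : ∀ n → c m (n * 2) ≡ k m (n * 2) ℤ.* c lo n
      at-odd  : ∀ n → c m (suc (n * 2)) ≡ k m (suc (n * 2)) ℤ.* c hi n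

  private
    a-even : ∀ n → a (n * 2) ≡ a n ℤ.* G (n * 2)
    a-even n = trans (step (n * 2)) (cong (λ h → a h ℤ.* G (n * 2)) (even/2 n))

    a-odd : ∀ n → a (suc (n * 2)) ≡ a n ℤ.* G (suc (n * 2))
    a-odd n = trans (step (suc (n * 2))) (cong (λ h → a h ℤ.* G (suc (n * 2))) (odd/2 n))

    pair : ∀ {x y n p} → a x ≡ a n ℤ.* G x → a y ≡ a p ℤ.* G y →
           a x ℤ.* a y ≡ G x ℤ.* G y ℤ.* (a n ℤ.* a p)
    pair {x} {y} {n} {p} ex ey = trans (cong₂ ℤ._*_ ex ey) (regroup (a n) (G x) (a p) (G y))
      where
      regroup : ∀ s t u v → s ℤ.* t ℤ.* (u ℤ.* v) ≡ t ℤ.* v ℤ.* (s ℤ.* u)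
      regroup = ℤ-Solver.solve-∀

    a-even′ : ∀ {x} n → x ≡ n * 2 → a x ≡ a n ℤ.* G x
    a-even′ n refl = a-even n

    a-odd′ : ∀ {x} n → x ≡ suc (n * 2) → a x ≡ a n ℤ.* G x
    a-odd′ n refl = a-odd n

  splits-even : ∀ m → Splits (m * 2) m m
  splits-even m = record
    { at-even = λ n → pair (a-even n) (a-even′ (n + m) (sym (ℕₚ.*-distribʳ-+ 2 n m)))
    ; at-odd  = λ n → pair (a-odd n) (a-odd′ (n + m) (cong suc (sym (ℕₚ.*-distribʳ-+ 2 n m))))
    }

  -- Adding an odd shift to an odd argument carries, so the halved shift is `suc m` there and `m` at
  -- even arguments.
  splits-odd : ∀ m → Splits (suc (m * 2)) m (suc m)
  splits-odd m = record
    { at-even = λ n → pair (a-even n)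
        (a-odd′ (n + m) (trans (ℕₚ.+-suc (n * 2) (m * 2)) (cong suc (sym (ℕₚ.*-distribʳ-+ 2 n m)))))
    ; at-odd  = λ n → pair (a-odd n)
        (a-even′ (n + suc m) (trans (sym (ℕₚ.+-suc (n * 2) (suc (m * 2)))) (sym (ℕₚ.*-distribʳ-+ 2 n (suc m)))))
    }

  κ-sign : ∀ m x → IsSign (k m x)
  κ-sign m x = sign-* (K.sign x) (K.sign (x + m))

  κ-periodic : ∀ m x → k m (16 + x) ≡ k m x
  κ-periodic m x = cong₂ ℤ._*_ (K.periodic x) (K.periodic (x + m))

  private
    bounded-* : ∀ {i j} → ∣ i ∣ ≤ 1 → IsSign j → ∣ i ℤ.* j ∣ ≤ 1
    bounded-* {i} {j} i≤1 σ = ℕₚ.≤-trans (∣i∣≤1⇒∣i*j∣≤∣j∣ i j i≤1) (∣sign∣≤1 σ)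

  evens-weight : ∀ m {w} → IsWeight w → IsWeight (evens (k m) w)
  evens-weight m {w} isW = record
    { periodic = λ n → cong₂ ℤ._*_ (trans (W.periodic (8 + n * 2)) (W.periodic (n * 2))) (κ-periodic m (n * 2))
    ; bounded  = λ n → bounded-* {w (n * 2)} (W.bounded (n * 2)) (κ-sign m (n * 2))
    }
    where module W = IsWeight isW

  odds-weight : ∀ m {w} → IsWeight w → IsWeight (odds (k m) w)
  odds-weight m {w} isW = record
    { periodic = λ n → cong₂ ℤ._*_ (trans (W.periodic (9 + n * 2)) (W.periodic (suc (n * 2)))) (κ-periodic m (suc (n * 2)))
    ; bounded  = λ n → bounded-* {w (suc (n * 2))} (W.bounded (suc (n * 2))) (κ-sign m (suc (n * 2)))
    }
    where module W = IsWeight isW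

  dev : (D : ℕ) (V : ℕ → ℤ) (m : ℕ) (w : ℕ → ℤ) → ℕ → ℤ
  dev D V m w n = + D ℤ.* (w n ℤ.* c m n) ℤ.- dot w V

  E : (D : ℕ) (V : ℕ → ℤ) (m : ℕ) (w : ℕ → ℤ) → ℕ → ℤ
  E D V m w N = ∑ N (dev D V m w)

  -- D · Σ_{n<N} w(n) a(n) a(n+m) = N · dot w V + o(N), uniformly in the weight w.
  record Density (D : ℕ) (V : ℕ → ℤ) (m : ℕ) : Set where
    field
      deviation : ∀ K → ∃ λ C → ∀ w → IsWeight w → ∀ N → K * ∣ E D V m w N ∣ ≤ N + C
  open Density public

  module _ (D : ℕ) (V : ℕ → ℤ) (m : ℕ) where
    B : ℕ
    B = D + norm 8 V

    ∣dev∣≤B : ∀ {w} → IsWeight w → ∀ n → ∣ dev D V m w n ∣ ≤ B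
    ∣dev∣≤B {w} isW n = begin
      ∣ + D ℤ.* (w n ℤ.* c m n) ℤ.- dot w V ∣          ≤⟨ ℤₚ.∣i-j∣≤∣i∣+∣j∣ (+ D ℤ.* (w n ℤ.* c m n)) (dot w V) ⟩
      ∣ + D ℤ.* (w n ℤ.* c m n) ∣ + ∣ dot w V ∣        ≡⟨ cong (_+ ∣ dot w V ∣) (ℤₚ.abs-* (+ D) (w n ℤ.* c m n)) ⟩
      D * ∣ w n ℤ.* c m n ∣ + ∣ dot w V ∣
        ≤⟨ ℕₚ.+-mono-≤ (ℕₚ.*-monoʳ-≤ D (bounded-* {w n} (IsWeight.bounded isW n) (c-sign m n))) (∣dot∣≤norm V isW) ⟩
      D * 1 + norm 8 V                                 ≡⟨ cong (_+ norm 8 V) (ℕₚ.*-identityʳ D) ⟩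
      D + norm 8 V                                     ∎
      where open ℕₚ.≤-Reasoning

    ∣E-suc∣ : ∀ {w} → IsWeight w → ∀ N → ∣ E D V m w (suc N) ∣ ≤ ∣ E D V m w N ∣ + B
    ∣E-suc∣ {w} isW N = ℕₚ.≤-trans (ℤₚ.∣i+j∣≤∣i∣+∣j∣ (E D V m w N) (dev D V m w N))
                                   (ℕₚ.+-monoʳ-≤ ∣ E D V m w N ∣ (∣dev∣≤B isW N))

    ∣E∣≤N*B : ∀ {w} → IsWeight w → ∀ N → ∣ E D V m w N ∣ ≤ N * B
    ∣E∣≤N*B isW zero    = z≤n
    ∣E∣≤N*B isW (suc N) = ℕₚ.≤-trans (∣E-suc∣ isW N)
      (ℕₚ.≤-trans (ℕₚ.+-monoˡ-≤ B (∣E∣≤N*B isW N)) (ℕₚ.≤-reflexive (ℕₚ.+-comm (N * B) B)))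

  private
    dot-double : ∀ {k X Y V} w → (∀ n → w (8 + n) ≡ w n) → (∀ r → r < 8 → + 2 ℤ.* V r ≡ fold k X Y r) →
                 dot w V ℤ.+ dot w V ≡ dot (evens k w) X ℤ.+ dot (odds k w) Y
    dot-double {k} {X} {Y} {V} w per 2V≡ = begin
      dot w V ℤ.+ dot w V                        ≡⟨ ∑-distrib-+ 8 (λ r → w r ℤ.* V r) (λ r → w r ℤ.* V r) ⟨
      ∑ 8 (λ r → w r ℤ.* V r ℤ.+ w r ℤ.* V r)    ≡⟨ ∑-cong< 8 (λ r r<8 → trans (twice (w r) (V r)) (cong (w r ℤ.*_) (2V≡ r r<8))) ⟩
      dot w (fold k X Y)                         ≡⟨ dot-fold k X Y w per ⟩
      dot (evens k w) X ℤ.+ dot (odds k w) Y     ∎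
      where
      open ≡-Reasoning
      twice : ∀ x y → x ℤ.* y ℤ.+ x ℤ.* y ≡ x ℤ.* (+ 2 ℤ.* y)
      twice = ℤ-Solver.solve-∀

  module _ {D m lo hi : ℕ} {X Y V : ℕ → ℤ} (splits : Splits m lo hi)
           (2V≡ : ∀ r → r < 8 → + 2 ℤ.* V r ≡ fold (k m) X Y r) where

    -- A pair of consecutive terms subtracts `dot w V` twice. The profile equation turns this into
    -- the pairings with the two halved profiles, so the deviations add up without any error.
    E-double : ∀ w → IsWeight w → ∀ N →
               E D V m w (N * 2) ≡ E D X lo (evens (k m) w) N ℤ.+ E D Y hi (odds (k m) w) N
    E-double w isW N = begin
      E D V m w (N * 2)                                                      ≡⟨ ∑-pairs N (dev D V m w) ⟩
      ∑ N (λ n → dev D V m w (n * 2) ℤ.+ dev D V m w (suc (n * 2)))          ≡⟨ ∑-cong N split ⟩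
      ∑ N (λ n → dev D X lo w₀ n ℤ.+ dev D Y hi w₁ n)                        ≡⟨ ∑-distrib-+ N (dev D X lo w₀) (dev D Y hi w₁) ⟩
      E D X lo w₀ N ℤ.+ E D Y hi w₁ N                                        ∎
      where
      open ≡-Reasoning
      w₀ w₁ : ℕ → ℤ
      w₀ = evens (k m) w
      w₁ = odds (k m) w
      gather : ∀ p q d → (p ℤ.- d) ℤ.+ (q ℤ.- d) ≡ p ℤ.+ q ℤ.- (d ℤ.+ d)
      gather = ℤ-Solver.solve-∀
      spread : ∀ p q d e → p ℤ.+ q ℤ.- (d ℤ.+ e) ≡ (p ℤ.- d) ℤ.+ (q ℤ.- e)
      spread = ℤ-Solver.solve-∀
      term : ∀ x {ν} → c m x ≡ k m x ℤ.* ν → + D ℤ.* (w x ℤ.* c m x) ≡ + D ℤ.* (w x ℤ.* k m x ℤ.* ν)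
      term x {ν} e = cong (+ D ℤ.*_) (trans (cong (w x ℤ.*_) e) (sym (ℤₚ.*-assoc (w x) (k m x) ν)))
      split : ∀ n → dev D V m w (n * 2) ℤ.+ dev D V m w (suc (n * 2)) ≡ dev D X lo w₀ n ℤ.+ dev D Y hi w₁ n
      split n = begin
        dev D V m w (n * 2) ℤ.+ dev D V m w (suc (n * 2))
          ≡⟨ gather (+ D ℤ.* (w (n * 2) ℤ.* c m (n * 2))) (+ D ℤ.* (w (suc (n * 2)) ℤ.* c m (suc (n * 2)))) (dot w V) ⟩
        + D ℤ.* (w (n * 2) ℤ.* c m (n * 2)) ℤ.+ + D ℤ.* (w (suc (n * 2)) ℤ.* c m (suc (n * 2))) ℤ.- (dot w V ℤ.+ dot w V)
          ≡⟨ cong₂ ℤ._-_ (cong₂ ℤ._+_ (term (n * 2) (Splits.at-even splits n)) (term (suc (n * 2)) (Splits.at-odd splits n)))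
                         (dot-double {k m} {X} {Y} {V} w (IsWeight.periodic isW) 2V≡) ⟩
        + D ℤ.* (w₀ n ℤ.* c lo n) ℤ.+ + D ℤ.* (w₁ n ℤ.* c hi n) ℤ.- (dot w₀ X ℤ.+ dot w₁ Y)
          ≡⟨ spread (+ D ℤ.* (w₀ n ℤ.* c lo n)) (+ D ℤ.* (w₁ n ℤ.* c hi n)) (dot w₀ X) (dot w₁ Y) ⟩
        dev D X lo w₀ n ℤ.+ dev D Y hi w₁ n ∎

    ∣E-even∣ : ∀ w → IsWeight w → ∀ N →
               ∣ E D V m w (N * 2) ∣ ≤ ∣ E D X lo (evens (k m) w) N ∣ + ∣ E D Y hi (odds (k m) w) N ∣
    ∣E-even∣ w isW N = ℕₚ.≤-trans (ℕₚ.≤-reflexive (cong ∣_∣ (E-double w isW N)))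
                                  (ℤₚ.∣i+j∣≤∣i∣+∣j∣ (E D X lo (evens (k m) w) N) (E D Y hi (odds (k m) w) N))

    ∣E-odd∣ : ∀ w → IsWeight w → ∀ N →
              ∣ E D V m w (suc (N * 2)) ∣ ≤ ∣ E D X lo (evens (k m) w) N ∣ + ∣ E D Y hi (odds (k m) w) N ∣ + B D V m
    ∣E-odd∣ w isW N = ℕₚ.≤-trans (∣E-suc∣ D V m isW (N * 2)) (ℕₚ.+-monoˡ-≤ (B D V m) (∣E-even∣ w isW N))

    -- The two sums of length `n` bring a slack of `n` each, which is exactly the slack allowed at
    -- length `n * 2`. A leftover last term costs at most `b`.
    density-split : Density D X lo → Density D Y hi → Density D V m
    density-split dX dY .deviation K with dX .deviation K | dY .deviation K
    ... | C₀ , bound₀ | C₁ , bound₁ = C₀ + C₁ + K * b , λ w isW N → go w isW (halves N)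
      where
      b : ℕ
      b = B D V m
      open ℕₚ.≤-Reasoning
      halved : ∀ w → IsWeight w → ∀ n → K * (∣ E D X lo (evens (k m) w) n ∣ + ∣ E D Y hi (odds (k m) w) n ∣) ≤ n * 2 + (C₀ + C₁)
      halved w isW n = begin
        K * (∣ E D X lo (evens (k m) w) n ∣ + ∣ E D Y hi (odds (k m) w) n ∣)
          ≡⟨ ℕₚ.*-distribˡ-+ K ∣ E D X lo (evens (k m) w) n ∣ ∣ E D Y hi (odds (k m) w) n ∣ ⟩
        K * ∣ E D X lo (evens (k m) w) n ∣ + K * ∣ E D Y hi (odds (k m) w) n ∣
          ≤⟨ ℕₚ.+-mono-≤ (bound₀ _ (evens-weight m isW) n) (bound₁ _ (odds-weight m isW) n) ⟩
        n + C₀ + (n + C₁)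
          ≡⟨ arith n C₀ C₁ ⟩
        n * 2 + (C₀ + C₁) ∎
        where
        arith : ∀ n C₀ C₁ → n + C₀ + (n + C₁) ≡ n * 2 + (C₀ + C₁)
        arith = ℕ-Solver.solve-∀
      go : ∀ w → IsWeight w → ∀ {N} → Halves N → K * ∣ E D V m w N ∣ ≤ N + (C₀ + C₁ + K * b)
      go w isW (even n) = begin
        K * ∣ E D V m w (n * 2) ∣      ≤⟨ ℕₚ.*-monoʳ-≤ K (∣E-even∣ w isW n) ⟩
        K * _                          ≤⟨ halved w isW n ⟩
        n * 2 + (C₀ + C₁)              ≤⟨ ℕₚ.+-monoʳ-≤ (n * 2) (ℕₚ.m≤m+n (C₀ + C₁) (K * b)) ⟩
        n * 2 + (C₀ + C₁ + K * b)      ∎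
      go w isW (odd n) = begin
        K * ∣ E D V m w (suc (n * 2)) ∣   ≤⟨ ℕₚ.*-monoʳ-≤ K (∣E-odd∣ w isW n) ⟩
        K * (e + b)                       ≡⟨ ℕₚ.*-distribˡ-+ K e b ⟩
        K * e + K * b                     ≤⟨ ℕₚ.+-monoˡ-≤ (K * b) (halved w isW n) ⟩
        n * 2 + (C₀ + C₁) + K * b         ≡⟨ ℕₚ.+-assoc (n * 2) (C₀ + C₁) (K * b) ⟩
        n * 2 + (C₀ + C₁ + K * b)         ≤⟨ ℕₚ.n≤1+n _ ⟩
        suc (n * 2) + (C₀ + C₁ + K * b)   ∎
        where
        e : ℕ
        e = ∣ E D X lo (evens (k m) w) n ∣ + ∣ E D Y hi (odds (k m) w) n ∣

  -- Every halving of N costs a bounded error, so E(N) grows at most logarithmically; instead of bounding by log N,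
  -- the induction on N absorbs the error as soon as N exceeds a multiple of it.
  density-self : ∀ {D m lo X V c₀} → Splits m lo m →
                 (∀ r → r < 8 → + 2 ℤ.* V r ≡ fold (k m) X V r) →
                 (∀ w → IsWeight w → ∀ N → ∣ E D X lo w N ∣ ≤ c₀) → Density D V m
  density-self {D} {m} {lo} {X} {V} {c₀} splits 2V≡ bound₀ .deviation K = C , λ w isW N → <-rec P next N w isW
    where
    b t C : ℕ
    b = B D V m
    -- `t` is `K` times the error of one halving. Below the threshold `suc t * 2` the trivial bound
    -- `N * b` suffices and dictates `C`; from there on half of `N` exceeds `t` and pays for the
    -- error.
    t = K * (c₀ + b)
    C = K * (suc t * 2 * b)
    P : ℕ → Set
    P N = ∀ w → IsWeight w → K * ∣ E D V m w N ∣ ≤ N + C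
    open ℕₚ.≤-Reasoning

    small : ∀ {N} → N < suc t * 2 → P N
    small {N} N<T w isW = begin
      K * ∣ E D V m w N ∣     ≤⟨ ℕₚ.*-monoʳ-≤ K (∣E∣≤N*B D V m isW N) ⟩
      K * (N * b)             ≤⟨ ℕₚ.*-monoʳ-≤ K (ℕₚ.*-monoˡ-≤ b (ℕₚ.<⇒≤ N<T)) ⟩
      C                       ≤⟨ ℕₚ.m≤n+m C N ⟩
      N + C                   ∎

    ascend : ∀ {n N} e → n * 2 ≤ N → t < n → K * e ≤ n + C → K * (c₀ + e + b) ≤ N + C
    ascend {n} {N} e n*2≤N t<n Ke≤ = begin
      K * (c₀ + e + b)        ≡⟨ arith K c₀ e b ⟩
      K * e + t               ≤⟨ ℕₚ.+-mono-≤ Ke≤ (ℕₚ.<⇒≤ t<n) ⟩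
      n + C + n               ≡⟨ arith′ n C ⟩
      n * 2 + C               ≤⟨ ℕₚ.+-monoˡ-≤ C n*2≤N ⟩
      N + C                   ∎
      where
      arith : ∀ K c e b → K * (c + e + b) ≡ K * e + K * (c + b)
      arith = ℕ-Solver.solve-∀
      arith′ : ∀ n C → n + C + n ≡ n * 2 + C
      arith′ = ℕ-Solver.solve-∀

    large : ∀ {N} → Halves N → suc t * 2 ≤ N → (∀ {n} → n < N → P n) → P N
    large (even n) T≤N ih w isW = ℕₚ.≤-trans (ℕₚ.*-monoʳ-≤ K (ℕₚ.≤-trans (∣E-even∣ {D} splits 2V≡ w isW n)
        (ℕₚ.≤-trans (ℕₚ.+-monoˡ-≤ _ (bound₀ _ (evens-weight m isW) n)) (ℕₚ.m≤m+n _ b))))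
      (ascend {n} ∣ E D V m (odds (k m) w) n ∣ ℕₚ.≤-refl t<n (ih (ℕₚ.m<m*n n 2 {{ℕ.>-nonZero (ℕₚ.≤-<-trans z≤n t<n)}} (s≤s (s≤s z≤n))) _ (odds-weight m isW)))
      where
      t<n : t < n
      t<n = ℕₚ.*-cancelʳ-≤ (suc t) n 2 T≤N
    large (odd n) T≤N ih w isW = ℕₚ.≤-trans (ℕₚ.*-monoʳ-≤ K (ℕₚ.≤-trans (∣E-odd∣ {D} splits 2V≡ w isW n)
        (ℕₚ.+-monoˡ-≤ b (ℕₚ.+-monoˡ-≤ _ (bound₀ _ (evens-weight m isW) n)))))
      (ascend {n} ∣ E D V m (odds (k m) w) n ∣ (ℕₚ.n≤1+n (n * 2)) t<n (ih (s≤s (n≤n*2 n)) _ (odds-weight m isW)))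
      where
      t<n : t < n
      t<n = ℕₚ.*-cancelʳ-< 2 t n (ℕ.s≤s⁻¹ T≤N)

    next : ∀ N → (∀ {n} → n < N → P n) → P N
    next N ih with N ℕ.<? suc t * 2
    ... | yes N<T = small N<T
    ... | no  N≮T = large (halves N) (ℕₚ.≮⇒≥ N≮T) ih

  -- The correlation with shift 0 is identically 1, so the deviations repeat with period 8 and sum to 0 over a period.
  E₀-bounded : ∀ v w → IsWeight w → ∀ N → ∣ E (8 * v) (λ _ → + v) 0 w N ∣ ≤ 8 * B (8 * v) (λ _ → + v) 0
  E₀-bounded v w isW = <-rec _ go
    where
    D : ℕ
    D = 8 * v
    V : ℕ → ℤ
    V _ = + v
    open ≡-Reasoning

    dev₀ : ∀ n → dev D V 0 w n ≡ + D ℤ.* w n ℤ.- dot w V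
    dev₀ n = cong (λ t → + D ℤ.* t ℤ.- dot w V) (begin
      w n ℤ.* (a n ℤ.* a (n + 0))   ≡⟨ cong (λ x → w n ℤ.* (a n ℤ.* a x)) (ℕₚ.+-identityʳ n) ⟩
      w n ℤ.* (a n ℤ.* a n)         ≡⟨ cong (w n ℤ.*_) (sign²≡1 (a-sign n)) ⟩
      w n ℤ.* 1ᶻ                    ≡⟨ ℤₚ.*-identityʳ (w n) ⟩
      w n ∎)

    period-sum : ∑ 8 (dev D V 0 w) ≡ 0ᶻ
    period-sum = begin
      ∑ 8 (dev D V 0 w)
        ≡⟨ ∑-cong 8 dev₀ ⟩
      ∑ 8 (λ n → + D ℤ.* w n ℤ.- dot w V)
        ≡⟨ cong (λ d → ∑ 8 (λ n → d ℤ.* w n ℤ.- dot w V)) (ℤₚ.pos-* 8 v) ⟩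
      ∑ 8 (λ n → + 8 ℤ.* + v ℤ.* w n ℤ.- dot w V)
        ≡⟨ cancel (+ v) (w 0) (w 1) (w 2) (w 3) (w 4) (w 5) (w 6) (w 7) ⟩
      0ᶻ ∎
      where
      cancel : ∀ v w₀ w₁ w₂ w₃ w₄ w₅ w₆ w₇ →
        let d = 0ᶻ ℤ.+ w₀ ℤ.* v ℤ.+ w₁ ℤ.* v ℤ.+ w₂ ℤ.* v ℤ.+ w₃ ℤ.* v ℤ.+ w₄ ℤ.* v ℤ.+ w₅ ℤ.* v ℤ.+ w₆ ℤ.* v ℤ.+ w₇ ℤ.* v in
        0ᶻ ℤ.+ (+ 8 ℤ.* v ℤ.* w₀ ℤ.- d) ℤ.+ (+ 8 ℤ.* v ℤ.* w₁ ℤ.- d) ℤ.+ (+ 8 ℤ.* v ℤ.* w₂ ℤ.- d) ℤ.+ (+ 8 ℤ.* v ℤ.* w₃ ℤ.- d)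
           ℤ.+ (+ 8 ℤ.* v ℤ.* w₄ ℤ.- d) ℤ.+ (+ 8 ℤ.* v ℤ.* w₅ ℤ.- d) ℤ.+ (+ 8 ℤ.* v ℤ.* w₆ ℤ.- d) ℤ.+ (+ 8 ℤ.* v ℤ.* w₇ ℤ.- d) ≡ 0ᶻ
      cancel = ℤ-Solver.solve-∀

    E-periodic : ∀ N → E D V 0 w (8 + N) ≡ E D V 0 w N
    E-periodic N = begin
      ∑ (8 + N) (dev D V 0 w)                                ≡⟨ ∑-split 8 N (dev D V 0 w) ⟩
      ∑ 8 (dev D V 0 w) ℤ.+ ∑ N (λ n → dev D V 0 w (8 + n))  ≡⟨ cong₂ ℤ._+_ period-sum (∑-cong N λ n →
        trans (dev₀ (8 + n)) (trans (cong (λ t → + D ℤ.* t ℤ.- dot w V) (IsWeight.periodic isW n)) (sym (dev₀ n)))) ⟩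
      0ᶻ ℤ.+ E D V 0 w N                                     ≡⟨ ℤₚ.+-identityˡ _ ⟩
      E D V 0 w N                                            ∎

    go : ∀ N → (∀ {n} → n < N → ∣ E D V 0 w n ∣ ≤ 8 * B D V 0) → ∣ E D V 0 w N ∣ ≤ 8 * B D V 0
    go N ih with N ℕ.≤? 8
    ... | yes N≤8 = ℕₚ.≤-trans (∣E∣≤N*B D V 0 isW N) (ℕₚ.*-monoˡ-≤ (B D V 0) N≤8)
    ... | no  N≰8 = subst (λ x → ∣ E D V 0 w x ∣ ≤ 8 * B D V 0) (ℕₚ.m+[n∸m]≡n 8≤N)
                      (subst (λ e → ∣ e ∣ ≤ 8 * B D V 0) (sym (E-periodic (N ∸ 8))) (ih (ℕₚ.∸-monoʳ-< {N} {8} {0} (s≤s z≤n) 8≤N)))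
      where
      8≤N : 8 ≤ N
      8≤N = ℕₚ.<⇒≤ (ℕₚ.≰⇒> N≰8)

  density-cong : ∀ {D V V′ m} → (∀ r → r < 8 → V r ≡ V′ r) → Density D V m → Density D V′ m
  density-cong {D} {V} {V′} {m} V≗V′ density .deviation K with density .deviation K
  ... | C , bound = C , λ w isW N → subst (λ e → K * ∣ e ∣ ≤ N + C) (∑-cong N (same w)) (bound w isW N)
    where
    same : ∀ w n → dev D V m w n ≡ dev D V′ m w n
    same w n = cong (λ d → + D ℤ.* (w n ℤ.* c m n) ℤ.- d) (∑-cong< 8 λ r r<8 → cong (w r ℤ.*_) (V≗V′ r r<8))

  density-double : ∀ {D V m} → Density D V m → Density (2 * D) (λ r → + 2 ℤ.* V r) m
  -- Doubling the scale doubles the deviation, hence the request for `K * 2`.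
  density-double {D} {V} {m} density .deviation K with density .deviation (K * 2)
  ... | C , bound = C , λ w isW N → ℕₚ.≤-trans (ℕₚ.≤-reflexive (doubled w N)) (bound w isW N)
    where
    open ≡-Reasoning
    dot-2 : ∀ w → dot w (λ r → + 2 ℤ.* V r) ≡ + 2 ℤ.* dot w V
    dot-2 w = trans (∑-cong 8 (λ r → swap (w r) (V r))) (sym (*-distribˡ-∑ (+ 2) 8 (λ r → w r ℤ.* V r)))
      where
      swap : ∀ x y → x ℤ.* (+ 2 ℤ.* y) ≡ + 2 ℤ.* (x ℤ.* y)
      swap = ℤ-Solver.solve-∀
    dev-2 : ∀ w n → dev (2 * D) (λ r → + 2 ℤ.* V r) m w n ≡ + 2 ℤ.* dev D V m w n
    dev-2 w n = trans (cong₂ (λ d e → d ℤ.* (w n ℤ.* c m n) ℤ.- e) (ℤₚ.pos-* 2 D) (dot-2 w)) (factor (+ D) (w n ℤ.* c m n) (dot w V))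
      where
      factor : ∀ d x e → + 2 ℤ.* d ℤ.* x ℤ.- + 2 ℤ.* e ≡ + 2 ℤ.* (d ℤ.* x ℤ.- e)
      factor = ℤ-Solver.solve-∀
    doubled : ∀ w N → K * ∣ E (2 * D) (λ r → + 2 ℤ.* V r) m w N ∣ ≡ K * 2 * ∣ E D V m w N ∣
    doubled w N = begin
      K * ∣ E (2 * D) (λ r → + 2 ℤ.* V r) m w N ∣   ≡⟨ cong (λ e → K * ∣ e ∣) (trans (∑-cong N (dev-2 w)) (sym (*-distribˡ-∑ (+ 2) N (dev D V m w)))) ⟩
      K * ∣ + 2 ℤ.* E D V m w N ∣                   ≡⟨ cong (K *_) (ℤₚ.abs-* (+ 2) (E D V m w N)) ⟩
      K * (2 * ∣ E D V m w N ∣)                     ≡⟨ ℕₚ.*-assoc K 2 ∣ E D V m w N ∣ ⟨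
      K * 2 * ∣ E D V m w N ∣                       ∎

  -- The division by 2 in the profile equation is moved into the scale, so the profile of `m` stays
  -- integral.
  density-fold : ∀ {D m lo hi X Y} → Splits m lo hi → Density D X lo → Density D Y hi → Density (2 * D) (fold (k m) X Y) m
  density-fold {D} {m} {lo} {hi} {X} {Y} splits dX dY =
    density-split {2 * D} {X = λ r → + 2 ℤ.* X r} {Y = λ r → + 2 ℤ.* Y r} splits
      (λ r _ → 2*fold r) (density-double dX) (density-double dY)
    where
    z : ℕ → ℤ
    z = interleave X Y
    pull : ∀ k k′ x x′ → + 2 ℤ.* (k ℤ.* x ℤ.+ k′ ℤ.* x′) ≡ k ℤ.* (+ 2 ℤ.* x) ℤ.+ k′ ℤ.* (+ 2 ℤ.* x′)
    pull = ℤ-Solver.solve-∀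
    2*fold : ∀ r → + 2 ℤ.* fold (k m) X Y r ≡ fold (k m) (λ r → + 2 ℤ.* X r) (λ r → + 2 ℤ.* Y r) r
    2*fold r = trans (pull (k m r) (k m (8 + r)) (z r) (z (8 + r)))
      (cong₂ (λ x x′ → k m r ℤ.* x ℤ.+ k m (8 + r) ℤ.* x′) (sym (interleave-* (+ 2) X Y r)) (sym (interleave-* (+ 2) X Y (8 + r))))

  -- Inheritance of zero profiles.

  Vanishes : ℕ → Set
  Vanishes m = Density 1 (λ _ → 0ᶻ) m

  density-zero : ∀ {D V m} → Density (suc D) V m → (∀ r → r < 8 → V r ≡ 0ᶻ) → Vanishes m
  density-zero {D} {V} {m} density V≡0 .deviation K with density .deviation K
  ... | C , bound = C , λ w isW N → ℕₚ.≤-trans (ℕₚ.*-monoʳ-≤ K (smaller w N)) (bound w isW N)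
    where
    rescale : ∀ d x → d ℤ.* x ℤ.- 0ᶻ ≡ d ℤ.* (+ 1 ℤ.* x ℤ.- 0ᶻ)
    rescale = ℤ-Solver.solve-∀
    dot≡0 : ∀ w {U} → (∀ r → r < 8 → U r ≡ 0ᶻ) → dot w U ≡ 0ᶻ
    dot≡0 w U≡0 = ∑-cong< 8 (λ r r<8 → trans (cong (w r ℤ.*_) (U≡0 r r<8)) (ℤₚ.*-zeroʳ (w r)))
    scaled : ∀ w n → dev (suc D) V m w n ≡ + suc D ℤ.* dev 1 (λ _ → 0ᶻ) m w n
    scaled w n = begin
      + suc D ℤ.* x ℤ.- dot w V                           ≡⟨ cong (λ d → + suc D ℤ.* x ℤ.- d) (dot≡0 w V≡0) ⟩
      + suc D ℤ.* x ℤ.- 0ᶻ                                ≡⟨ rescale (+ suc D) x ⟩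
      + suc D ℤ.* (+ 1 ℤ.* x ℤ.- 0ᶻ)                      ≡⟨ cong (λ d → + suc D ℤ.* (+ 1 ℤ.* x ℤ.- d)) (dot≡0 w {λ _ → 0ᶻ} (λ _ _ → refl)) ⟨
      + suc D ℤ.* (+ 1 ℤ.* x ℤ.- dot w (λ _ → 0ᶻ))        ∎
      where
      open ≡-Reasoning
      x : ℤ
      x = w n ℤ.* c m n
    smaller : ∀ w N → ∣ E 1 (λ _ → 0ᶻ) m w N ∣ ≤ ∣ E (suc D) V m w N ∣
    smaller w N = begin
      e                                     ≤⟨ ℕₚ.m≤n*m e (suc D) ⟩
      suc D * e                             ≡⟨ ℤₚ.abs-* (+ suc D) (E 1 (λ _ → 0ᶻ) m w N) ⟨
      ∣ + suc D ℤ.* E 1 (λ _ → 0ᶻ) m w N ∣  ≡⟨ cong ∣_∣ (trans (*-distribˡ-∑ (+ suc D) N _) (sym (∑-cong N (scaled w)))) ⟩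
      ∣ E (suc D) V m w N ∣                 ∎
      where
      open ℕₚ.≤-Reasoning
      e : ℕ
      e = ∣ E 1 (λ _ → 0ᶻ) m w N ∣

  vanishes-split : ∀ {m lo hi} → Splits m lo hi → Vanishes lo → Vanishes hi → Vanishes m
  vanishes-split {m} splits vlo vhi = density-split {1} {X = λ _ → 0ᶻ} {Y = λ _ → 0ᶻ} splits zeros vlo vhi
    where
    interleave-0 : ∀ x → interleave (λ _ → 0ᶻ) (λ _ → 0ᶻ) x ≡ 0ᶻ
    interleave-0 zero          = refl
    interleave-0 (suc zero)    = refl
    interleave-0 (suc (suc x)) = interleave-0 x
    zeros : ∀ r → r < 8 → 0ᶻ ≡ fold (k m) (λ _ → 0ᶻ) (λ _ → 0ᶻ) r
    zeros r _ = sym (cong₂ ℤ._+_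
      (trans (cong (k m r ℤ.*_) (interleave-0 r)) (ℤₚ.*-zeroʳ (k m r)))
      (trans (cong (k m (8 + r) ℤ.*_) (interleave-0 (8 + r))) (ℤₚ.*-zeroʳ (k m (8 + r)))))

  -- Both halves of a shift that is at least 8 are smaller and still at least 4, so the block from 4
  -- to 7 is a sufficient base.
  vanishes-4+ : (∀ m → m < 4 → Vanishes (4 + m)) → ∀ m → 4 ≤ m → Vanishes m
  vanishes-4+ base4 = <-rec (λ m → 4 ≤ m → Vanishes m) go
    where
    go : ∀ m → (∀ {l} → l < m → 4 ≤ l → Vanishes l) → 4 ≤ m → Vanishes m
    go m ih 4≤m with m ℕ.<? 8
    ... | yes m<8 = subst Vanishes (ℕₚ.m+[n∸m]≡n 4≤m) (base4 (m ∸ 4) (ℕₚ.∸-monoˡ-< m<8 4≤m))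
    ... | no  m≮8 with halves m
    ...   | even l = vanishes-split (splits-even l) v v
      where
      4≤l : 4 ≤ l
      4≤l = ℕₚ.*-cancelʳ-≤ 4 l 2 (ℕₚ.≮⇒≥ m≮8)
      v : Vanishes l
      v = ih (ℕₚ.m<m*n l 2 {{ℕ.>-nonZero (ℕₚ.≤-trans (s≤s z≤n) 4≤l)}} (s≤s (s≤s z≤n))) 4≤l
    ...   | odd l = vanishes-split (splits-odd l) (ih (s≤s (n≤n*2 l)) 4≤l)
                      (ih (s≤s (ℕₚ.m<m*n l 2 {{ℕ.>-nonZero (ℕₚ.≤-trans (s≤s z≤n) 4≤l)}} (s≤s (s≤s z≤n)))) (ℕₚ.m≤n⇒m≤1+n 4≤l))
      where
      4≤l : 4 ≤ l
      4≤l = ℕₚ.*-cancelʳ-< 2 3 l (ℕ.s≤s⁻¹ (ℕₚ.≮⇒≥ m≮8))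

  -- Correlation limits and the sum of the profile.

  private
    1ʷ : ℕ → ℤ
    1ʷ _ = 1ᶻ

    dot-1 : ∀ V → dot 1ʷ V ≡ ∑ 8 V
    dot-1 V = ∑-cong 8 (λ r → ℤₚ.*-identityˡ (V r))

    E-1 : ∀ D V m N → E D V m 1ʷ N ≡ + D ℤ.* corrSum a m N ℤ.- + N ℤ.* ∑ 8 V
    E-1 D V m zero    = sym (trans (cong (ℤ._- + 0 ℤ.* ∑ 8 V) (ℤₚ.*-zeroʳ (+ D))) (cong (λ t → 0ᶻ ℤ.- t) (ℤₚ.*-zeroˡ (∑ 8 V))))
    E-1 D V m (suc N) = begin
      E D V m 1ʷ N ℤ.+ (+ D ℤ.* (1ᶻ ℤ.* c m N) ℤ.- dot 1ʷ V)
        ≡⟨ cong₂ (λ e d → e ℤ.+ (+ D ℤ.* (1ᶻ ℤ.* c m N) ℤ.- d)) (E-1 D V m N) (dot-1 V) ⟩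
      + D ℤ.* corrSum a m N ℤ.- + N ℤ.* ∑ 8 V ℤ.+ (+ D ℤ.* (1ᶻ ℤ.* c m N) ℤ.- ∑ 8 V)
        ≡⟨ collect (+ D) (corrSum a m N) (+ N) (∑ 8 V) (c m N) ⟩
      + D ℤ.* (corrSum a m N ℤ.+ c m N) ℤ.- (1ᶻ ℤ.+ + N) ℤ.* ∑ 8 V ∎
      where
      open ≡-Reasoning
      collect : ∀ d s n v x → d ℤ.* s ℤ.- n ℤ.* v ℤ.+ (d ℤ.* (1ᶻ ℤ.* x) ℤ.- v) ≡ d ℤ.* (s ℤ.+ x) ℤ.- (1ᶻ ℤ.+ n) ℤ.* v
      collect = ℤ-Solver.solve-∀

  sum≡0⇒corrToZero : ∀ {D V m} → Density (suc D) V m → ∑ 8 V ≡ 0ᶻ → CorrToZero a m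
  -- The factor 2 leaves room for the constant: `suc N + C` is below `2 * suc N` once `C ≤ N`, so
  -- `C` itself is the threshold.
  sum≡0⇒corrToZero {D} {V} {m} density ∑V≡0 ε 0<ε with density .deviation (2 * ↧ₙ ε)
  ... | C , bound = C , λ N C≤N → small⇒∣/∣<ε (corrSum a m (suc N)) N ε 0<ε (small N C≤N)
    where
    open ℕₚ.≤-Reasoning
    q : ℕ
    q = ↧ₙ ε
    s : ℕ → ℤ
    s N = corrSum a m (suc N)
    E≡ : ∀ N → E (suc D) V m 1ʷ (suc N) ≡ + suc D ℤ.* s N
    E≡ N = trans (E-1 (suc D) V m (suc N)) (trans (cong (λ v → + suc D ℤ.* s N ℤ.- + suc N ℤ.* v) ∑V≡0)
             (trans (cong (λ v → + suc D ℤ.* s N ℤ.- v) (ℤₚ.*-zeroʳ (+ suc N))) (ℤₚ.+-identityʳ _)))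
    small : ∀ N → C ≤ N → q * ∣ s N ∣ < suc N
    small N C≤N = ℕₚ.*-cancelˡ-< 2 _ _ (begin-strict
      2 * (q * ∣ s N ∣)                          ≡⟨ ℕₚ.*-assoc 2 q ∣ s N ∣ ⟨
      2 * q * ∣ s N ∣                            ≤⟨ ℕₚ.*-monoʳ-≤ (2 * q) (ℕₚ.m≤n*m ∣ s N ∣ (suc D)) ⟩
      2 * q * (suc D * ∣ s N ∣)                  ≡⟨ cong (2 * q *_) (ℤₚ.abs-* (+ suc D) (s N)) ⟨
      2 * q * ∣ + suc D ℤ.* s N ∣                ≡⟨ cong (λ e → 2 * q * ∣ e ∣) (E≡ N) ⟨
      2 * q * ∣ E (suc D) V m 1ʷ (suc N) ∣       ≤⟨ bound 1ʷ (constant 1ᶻ (inj₁ refl)) (suc N) ⟩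
      suc N + C                                  <⟨ ℕₚ.+-monoʳ-< (suc N) (s≤s C≤N) ⟩
      suc N + suc N                              ≡⟨ cong (λ t → suc N + t) (ℕₚ.+-identityʳ (suc N)) ⟨
      2 * suc N                                  ∎)

  -- The sum `v` is an integer, so if nonzero it makes the main term `n * v` at least `n` in
  -- absolute value. That term is `suc D` times the correlation sum minus the deviation. With ε = 1
  -- / (4 · `suc D`) and `K` = 4 these are bounded by n/4 and (n + C)/4, which is too little because
  -- `n` exceeds `C`.
  corrToZero⇒sum≡0 : ∀ {D V m} → Density (suc D) V m → CorrToZero a m → ∑ 8 V ≡ 0ᶻ
  corrToZero⇒sum≡0 {D} {V} {m} density corr with density .deviation 4 | corr (+ 1 ℚ./ suc (D + 3 * suc D)) (0<1/d (D + 3 * suc D))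
  ... | C , bound | N₀ , small = ℤₚ.∣i∣≡0⇒i≡0 (decidable-stable (∣ v ∣ ℕ.≟ 0) λ v≢0 → ℕₚ.<-irrefl refl (absurd v≢0))
    where
    v : ℤ
    v = ∑ 8 V
    N n : ℕ
    N = N₀ + C
    n = suc N
    s e : ℤ
    s = corrSum a m n
    e = E (suc D) V m 1ʷ n
    isolate : ∀ d s n v → n ℤ.* v ≡ d ℤ.* s ℤ.- (d ℤ.* s ℤ.- n ℤ.* v)
    isolate = ℤ-Solver.solve-∀
    arith : ∀ D x → 4 * (suc D * x) ≡ suc (D + 3 * suc D) * x
    arith = ℕ-Solver.solve-∀
    arith′ : ∀ N₀ C → suc (N₀ + C) + (suc (N₀ + C) + C) + (2 * N₀ + C + 2) ≡ 4 * suc (N₀ + C)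
    arith′ = ℕ-Solver.solve-∀
    open ℕₚ.≤-Reasoning
    absurd : ∣ v ∣ ≢ 0 → 4 * n < 4 * n
    absurd v≢0 = begin-strict
      4 * n                                        ≤⟨ ℕₚ.*-monoʳ-≤ 4 (ℕₚ.m≤m*n n ∣ v ∣ {{ℕ.≢-nonZero v≢0}}) ⟩
      4 * (n * ∣ v ∣)                              ≡⟨ cong (4 *_) (ℤₚ.abs-* (+ n) v) ⟨
      4 * ∣ + n ℤ.* v ∣                            ≡⟨ cong (λ t → 4 * ∣ t ∣) (trans (isolate (+ suc D) s (+ n) v) (cong (λ t → + suc D ℤ.* s ℤ.- t) (sym (E-1 (suc D) V m n)))) ⟩
      4 * ∣ + suc D ℤ.* s ℤ.- e ∣                  ≤⟨ ℕₚ.*-monoʳ-≤ 4 (ℤₚ.∣i-j∣≤∣i∣+∣j∣ (+ suc D ℤ.* s) e) ⟩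
      4 * (∣ + suc D ℤ.* s ∣ + ∣ e ∣)              ≡⟨ cong (λ t → 4 * (t + ∣ e ∣)) (ℤₚ.abs-* (+ suc D) s) ⟩
      4 * (suc D * ∣ s ∣ + ∣ e ∣)                  ≡⟨ ℕₚ.*-distribˡ-+ 4 (suc D * ∣ s ∣) ∣ e ∣ ⟩
      4 * (suc D * ∣ s ∣) + 4 * ∣ e ∣              ≡⟨ cong (_+ 4 * ∣ e ∣) (arith D ∣ s ∣) ⟩
      suc (D + 3 * suc D) * ∣ s ∣ + 4 * ∣ e ∣      <⟨ ℕₚ.+-mono-<-≤ (∣/∣<1/d⇒small s N (D + 3 * suc D) (small N (ℕₚ.m≤m+n N₀ C))) (bound 1ʷ (constant 1ᶻ (inj₁ refl)) n) ⟩
      n + (n + C)                                  ≤⟨ ℕₚ.m≤m+n _ (2 * N₀ + C + 2) ⟩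
      n + (n + C) + (2 * N₀ + C + 2)               ≡⟨ arith′ N₀ C ⟩
      4 * n                                        ∎

-- Pattern counts when a binary digit is appended.

_≟ʷ_ : (v w : Word) → Dec (v ≡ w)
_≟ʷ_ = Listₚ.≡-dec _≟ᶠ_

-- A prefix of `w ∷ʳ c` that is not a prefix of `w` must be the whole word, and the two cases
-- exclude each other.
prefix-∷ʳ : ∀ v w c → ind (isPrefix v (w ∷ʳ c)) ≡ ind (isPrefix v w) + ind (does (v ≟ʷ (w ∷ʳ c)))
prefix-∷ʳ []          []      c = refl
prefix-∷ʳ []          (_ ∷ _) c = refl
prefix-∷ʳ (b ∷ [])    []      c with does (b ≟ᶠ c)
... | true  = refl
... | false = refl
prefix-∷ʳ (b ∷ _ ∷ _) []      c with does (b ≟ᶠ c)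
... | true  = refl
... | false = refl
prefix-∷ʳ (b ∷ v)     (d ∷ w) c with does (b ≟ᶠ d)
... | true  = prefix-∷ʳ v w c
... | false = refl

does-reverse : ∀ v w → does (v ≟ʷ w) ≡ does (reverse v ≟ʷ reverse w)
does-reverse v w = does-⇔ (mk⇔ (cong reverse) Listₚ.reverse-injective) (v ≟ʷ w) (reverse v ≟ʷ reverse w)

occ-short : ∀ v w → length w < length v → occ v w ≡ 0
occ-short v w w<v = go w w<v
  where
  noPrefix : ∀ v w → length w < length v → isPrefix v w ≡ false
  noPrefix (_ ∷ _) []      _         = refl
  noPrefix (b ∷ v) (c ∷ w) (s≤s w<v) = trans (cong (does (b ≟ᶠ c) ∧_) (noPrefix v w w<v)) (∧-zeroʳ _)
  go : ∀ w → length w < length v → occ v w ≡ 0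
  go []      l<v = cong ind (noPrefix v [] l<v)
  go (c ∷ w) l<v = cong₂ _+_ (cong ind (noPrefix v (c ∷ w) l<v)) (go w (ℕₚ.<-trans (ℕₚ.n<1+n _) l<v))

-- `occ` counts by left ends, whereas the new occurrence is the one at the right end. By `prefix-∷ʳ`
-- a left end gains an occurrence iff the rest of the extended word equals `v`; the prefix test on
-- the reversed words unfolds into the same equalities.
occ-∷ʳ : ∀ v w c → 0 < length v → occ v (w ∷ʳ c) ≡ occ v w + ind (isPrefix (reverse v) (reverse (w ∷ʳ c)))
occ-∷ʳ v [] c 0<v = begin
  ind (isPrefix v (c ∷ [])) + occ v []                              ≡⟨ cong₂ _+_ (prefix-∷ʳ v [] c) (occ-short v [] 0<v) ⟩
  ind (isPrefix v []) + ind (does (v ≟ʷ (c ∷ []))) + 0              ≡⟨ ℕₚ.+-identityʳ _ ⟩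
  ind (isPrefix v []) + ind (does (v ≟ʷ (c ∷ [])))                  ≡⟨ cong (λ t → occ v [] + ind t) (does-reverse v (c ∷ [])) ⟩
  occ v [] + ind (does (reverse v ≟ʷ (c ∷ [])))
    ≡⟨ cong (λ t → occ v [] + (t + ind (does (reverse v ≟ʷ (c ∷ []))))) (occ-short (reverse v) [] (subst (0 <_) (sym (Listₚ.length-reverse v)) 0<v)) ⟨
  occ v [] + (ind (isPrefix (reverse v) []) + ind (does (reverse v ≟ʷ (c ∷ []))))
    ≡⟨ cong (λ t → occ v [] + t) (prefix-∷ʳ (reverse v) [] c) ⟨
  occ v [] + ind (isPrefix (reverse v) (c ∷ []))                    ∎
  where open ≡-Reasoning
occ-∷ʳ v (d ∷ w) c 0<v = begin
  ind (isPrefix v (d ∷ u)) + occ v u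
    ≡⟨ cong₂ _+_ (prefix-∷ʳ v (d ∷ w) c) (occ-∷ʳ v w c 0<v) ⟩
  ind (isPrefix v (d ∷ w)) + ind (does (v ≟ʷ (d ∷ u))) + (occ v w + ind (isPrefix (reverse v) (reverse u)))
    ≡⟨ regroup (ind (isPrefix v (d ∷ w))) (ind (does (v ≟ʷ (d ∷ u)))) (occ v w) _ ⟩
  occ v (d ∷ w) + (ind (isPrefix (reverse v) (reverse u)) + ind (does (v ≟ʷ (d ∷ u))))
    ≡⟨ cong (λ t → occ v (d ∷ w) + (ind (isPrefix (reverse v) (reverse u)) + ind t))
         (trans (does-reverse v (d ∷ u)) (cong (λ z → does (reverse v ≟ʷ z)) (Listₚ.unfold-reverse d u))) ⟩
  occ v (d ∷ w) + (ind (isPrefix (reverse v) (reverse u)) + ind (does (reverse v ≟ʷ (reverse u ∷ʳ d))))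
    ≡⟨ cong (λ t → occ v (d ∷ w) + t) (prefix-∷ʳ (reverse v) (reverse u) d) ⟨
  occ v (d ∷ w) + ind (isPrefix (reverse v) (reverse u ∷ʳ d))
    ≡⟨ cong (λ z → occ v (d ∷ w) + ind (isPrefix (reverse v) z)) (Listₚ.unfold-reverse d u) ⟨
  occ v (d ∷ w) + ind (isPrefix (reverse v) (reverse (d ∷ u))) ∎
  where
  open ≡-Reasoning
  u : Word
  u = w ∷ʳ c
  regroup : ∀ x y z t → x + y + (z + t) ≡ x + z + (t + y)
  regroup = ℕ-Solver.solve-∀

-- The first letter of u is compared with the least significant digit of x; beyond its leading digit x continues with 0s.
endsWith : Word → ℕ → Bool
endsWith []      x = true
endsWith (c ∷ u) x = does (c ≟ᶠ bit x) ∧ endsWith u (x / 2)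

1+m/2≤m : ∀ m → suc m / 2 ≤ m
1+m/2≤m m = ℕ.s≤s⁻¹ (ℕᵈ.m/n<m (suc m) 2 (s≤s (s≤s z≤n)))

bitsLE-fuel : ∀ {f g} n → n ≤ f → n ≤ g → bitsLE f n ≡ bitsLE g n
bitsLE-fuel {zero}  {zero}  zero    _ _ = refl
bitsLE-fuel {zero}  {suc g} zero    _ _ = refl
bitsLE-fuel {suc f} {zero}  zero    _ _ = refl
bitsLE-fuel {suc f} {suc g} zero    _ _ = refl
bitsLE-fuel {suc f} {suc g} (suc n) (s≤s n≤f) (s≤s n≤g) =
  cong (bit (suc n) ∷_) (bitsLE-fuel (suc n / 2) (ℕₚ.≤-trans (1+m/2≤m n) n≤f) (ℕₚ.≤-trans (1+m/2≤m n) n≤g))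

-- The padding plays the role of the zeros that `endsWith` reads beyond the leading digit; the
-- length bound says that there are enough of them.
isPrefix-bits : ∀ u f x k → x ≤ f → length u ≤ length (bitsLE f x) + k →
                isPrefix u (bitsLE f x ++ replicate k zero) ≡ endsWith u x
isPrefix-bits []      f       x       k       _         _         = refl
isPrefix-bits (c ∷ u) zero    zero    (suc k) x≤f       (s≤s l≤k) = cong (does (c ≟ᶠ zero) ∧_) (isPrefix-bits u zero zero k z≤n l≤k)
isPrefix-bits (c ∷ u) (suc f) zero    (suc k) x≤f       (s≤s l≤k) = cong (does (c ≟ᶠ zero) ∧_) (isPrefix-bits u zero zero k z≤n l≤k)
isPrefix-bits (c ∷ u) (suc f) (suc x) k       (s≤s x≤f) (s≤s l≤)  =
  cong (does (c ≟ᶠ bit (suc x)) ∧_) (isPrefix-bits u f (suc x / 2) k (ℕₚ.≤-trans (1+m/2≤m x) x≤f) l≤)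

endsWith-0 : ∀ {u} → NotZeros u → endsWith u 0 ≡ false
endsWith-0 (here refl)     = refl
endsWith-0 {c ∷ _} (there one) = trans (cong (does (c ≟ᶠ zero) ∧_) (endsWith-0 one)) (∧-zeroʳ _)

reverse-replicate : ∀ {A : Set} n (x : A) → reverse (replicate n x) ≡ replicate n x
reverse-replicate zero    x = refl
reverse-replicate (suc n) x = trans (Listₚ.unfold-reverse x (replicate n x)) (trans (cong (_∷ʳ x) (reverse-replicate n x)) (snoc n))
  where
  snoc : ∀ n → replicate n x ∷ʳ x ≡ x ∷ replicate n x
  snoc zero    = refl
  snoc (suc n) = cong (x ∷_) (snoc n)

0<length : ∀ {v} → NotZeros v → 0 < length v
0<length {_ ∷ _} _ = s≤s z≤n

count#-step : ∀ {v} → NotZeros v → ∀ x → count# v x ≡ count# v (x / 2) + ind (endsWith (reverse v) x)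
-- 0 is its own half and gains no digit, so nothing may be added; this holds because `v` contains a
-- 1.
count#-step {v} one zero = sym (trans (cong (λ t → count# v 0 + ind t) (endsWith-0 (Anyₚ.reverse⁺ one))) (ℕₚ.+-identityʳ _))
count#-step {v} one x@(suc y) = begin
  occ v (p ++ binary x)
    ≡⟨ cong (occ v) snoc ⟩
  occ v ((p ++ binary (x / 2)) ∷ʳ bit x)
    ≡⟨ occ-∷ʳ v (p ++ binary (x / 2)) (bit x) (0<length one) ⟩
  count# v (x / 2) + ind (isPrefix (reverse v) (reverse ((p ++ binary (x / 2)) ∷ʳ bit x)))
    ≡⟨ cong (λ z → count# v (x / 2) + ind (isPrefix (reverse v) (reverse z))) snoc ⟨
  count# v (x / 2) + ind (isPrefix (reverse v) (reverse (p ++ binary x)))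
    ≡⟨ cong (λ z → count# v (x / 2) + ind (isPrefix (reverse v) z)) reversed ⟩
  count# v (x / 2) + ind (isPrefix (reverse v) (bitsLE x x ++ p))
    ≡⟨ cong (λ b → count# v (x / 2) + ind b) (isPrefix-bits (reverse v) x x l ℕₚ.≤-refl long) ⟩
  count# v (x / 2) + ind (endsWith (reverse v) x) ∎
  where
  open ≡-Reasoning
  l : ℕ
  l = length v ∸ 1
  p : Word
  p = replicate l zero
  snoc : p ++ binary x ≡ (p ++ binary (x / 2)) ∷ʳ bit x
  snoc = begin
    p ++ reverse (bit x ∷ bitsLE y (x / 2))           ≡⟨ cong (λ z → p ++ reverse (bit x ∷ z)) (bitsLE-fuel (x / 2) (1+m/2≤m y) ℕₚ.≤-refl) ⟩
    p ++ reverse (bit x ∷ bitsLE (x / 2) (x / 2))     ≡⟨ cong (p ++_) (Listₚ.unfold-reverse (bit x) (bitsLE (x / 2) (x / 2))) ⟩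
    p ++ (binary (x / 2) ∷ʳ bit x)                    ≡⟨ Listₚ.++-assoc p (binary (x / 2)) (bit x ∷ []) ⟨
    (p ++ binary (x / 2)) ∷ʳ bit x                    ∎
  reversed : reverse (p ++ binary x) ≡ bitsLE x x ++ p
  reversed = trans (Listₚ.reverse-++ p (binary x)) (cong₂ _++_ (Listₚ.reverse-involutive (bitsLE x x)) (reverse-replicate l zero))
  -- A positive `x` has at least one digit, which makes up for the padding being one shorter than
  -- `v`.
  long : length (reverse v) ≤ length (bitsLE x x) + l
  long = ℕₚ.≤-trans (ℕₚ.≤-reflexive (Listₚ.length-reverse v))
           (ℕₚ.≤-trans (ℕₚ.m≤n+m∸n (length v) 1) (ℕₚ.+-monoˡ-≤ l {1} {length (bitsLE x x)} (s≤s z≤n)))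

count#-0 : ∀ {v} → NotZeros v → count# v 0 ≡ 0
count#-0 {v} one = occ-short v w (subst (_< length v) (sym ∣w∣≡) (ℕₚ.∸-monoʳ-< {length v} {1} {0} (s≤s z≤n) (0<length one)))
  where
  w : Word
  w = replicate (length v ∸ 1) zero ++ []
  ∣w∣≡ : length w ≡ length v ∸ 1
  ∣w∣≡ = trans (cong length (Listₚ.++-identityʳ (replicate (length v ∸ 1) (zero {1})))) (Listₚ.length-replicate (length v ∸ 1))

endings : List Word → ℕ → ℕ
endings []      x = 0
endings (v ∷ A) x = ind (endsWith (reverse v) x) + endings A x

totalCount-step : ∀ {A} → All NotZeros A → ∀ x → totalCount A x ≡ totalCount A (x / 2) + endings A x
totalCount-step []                    x = refl
totalCount-step {v ∷ A} (one ∷ ones) x = trans (cong₂ _+_ (count#-step one x) (totalCount-step ones x))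
    (regroup (count# v (x / 2)) (ind (endsWith (reverse v) x)) (totalCount A (x / 2)) (endings A x))
  where
  regroup : ∀ x y z t → x + y + (z + t) ≡ x + z + (y + t)
  regroup = ℕ-Solver.solve-∀

totalCount-0 : ∀ {A} → All NotZeros A → totalCount A 0 ≡ 0
totalCount-0 []           = refl
totalCount-0 (one ∷ ones) = cong₂ _+_ (count#-0 one) (totalCount-0 ones)

[-1]^_ : ℕ → ℤ
[-1]^ n = (ℤ.- (+ 1)) ℤ.^ n

patternSeq-generated : ∀ {A} → All NotZeros A → Generates (λ x → [-1]^ (endings A x)) (patternSeq A)
patternSeq-generated {A} ones = record
  { base = cong [-1]^_ (totalCount-0 ones)
  ; step = λ x → trans (cong [-1]^_ (totalCount-step ones x)) (ℤₚ.^-distribˡ-+-* (ℤ.- (+ 1)) (totalCount A (x / 2)) (endings A x))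
  }

bit-%2 : ∀ {x y} → x % 2 ≡ y % 2 → bit x ≡ bit y
bit-%2 {x} {y} e = trans (bit≡ x) (trans (cong digit e) (sym (bit≡ y)))
  where
  digit : ℕ → Digit
  digit zero    = zero
  digit (suc _) = suc zero
  bit≡ : ∀ x → bit x ≡ digit (x % 2)
  bit≡ x with x % 2
  ... | zero  = refl
  ... | suc _ = refl

endsWith-%2^ : ∀ n u x .{{_ : ℕ.NonZero (2 ^ n)}} → length u ≤ n → endsWith u (x % 2 ^ n) ≡ endsWith u x
endsWith-%2^ n       []      x _         = refl
endsWith-%2^ (suc n) (c ∷ u) x (s≤s l≤n) = cong₂ (λ b t → does (c ≟ᶠ b) ∧ t)
  (bit-%2 {x % 2 ^ suc n} {x} (ℕᵈ.m∣n⇒o%n%m≡o%m 2 (2 ^ suc n) x (m∣m*n (2 ^ n))))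
  (trans (cong (endsWith u) halve) (endsWith-%2^ n u (x / 2) l≤n))
  where
  instance
    2^n≢0 : ℕ.NonZero (2 ^ n)
    2^n≢0 = ℕₚ.m^n≢0 2 n
    2^n*2≢0 : ℕ.NonZero (2 ^ n * 2)
    2^n*2≢0 = ℕₚ.m*n≢0 (2 ^ n) 2
  halve : x % 2 ^ suc n / 2 ≡ x / 2 % 2 ^ n
  halve = trans (cong (_/ 2) (ℕᵈ.%-congʳ {o = x} (ℕₚ.*-comm 2 (2 ^ n)))) (ℕᵈ.m%[n*o]/o≡m/o%n x (2 ^ n) 2)

endings-%16 : ∀ {A} → All (λ v → length v ≤ 4) A → ∀ x → endings A (x % 16) ≡ endings A x
endings-%16 []                  x = refl
endings-%16 {v ∷ A} (v≤4 ∷ A≤4) x = cong₂ (λ b t → ind b + t)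
  (endsWith-%2^ 4 (reverse v) x (subst (_≤ 4) (sym (Listₚ.length-reverse v)) v≤4)) (endings-%16 A≤4 x)

-- Kernels as tables of 15 bits.

-- Entry i is true iff the kernel takes the value −1 at i + 1.
Table : Set
Table = Vec Bool 15

at : ∀ {A : Set} {n} → A → Vec A n → ℕ → A
at d []       _       = d
at d (x ∷ xs) zero    = x
at d (x ∷ xs) (suc i) = at d xs i

tab : ∀ {A : Set} n → (ℕ → A) → Vec A n
tab zero    f = []
tab (suc n) f = f 0 ∷ tab n (f ∘ suc)

at-tab : ∀ {A : Set} {d : A} {n} (f : ℕ → A) i → i < n → at d (tab n f) i ≡ f i
at-tab {n = suc n} f zero    _         = refl
at-tab {n = suc n} f (suc i) (s≤s i<n) = at-tab (f ∘ suc) i i<n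

at-injective : ∀ {A : Set} {d : A} {n} (v w : Vec A n) → (∀ i → i < n → at d v i ≡ at d w i) → v ≡ w
at-injective []       []       _ = refl
at-injective (x ∷ xs) (y ∷ ys) e = cong₂ _∷_ (e 0 (s≤s z≤n)) (at-injective xs ys (λ i i<n → e (suc i) (s≤s i<n)))

sgn : Bool → ℤ
sgn false = 1ᶻ
sgn true  = ℤ.- 1ᶻ

sgn-injective : ∀ {b c} → sgn b ≡ sgn c → b ≡ c
sgn-injective {false} {false} _ = refl
sgn-injective {true}  {true}  _ = refl

-- The prepended `false` gives the value 1 at the residue 0: an admissible word of length at most 4
-- does not match four final zeros.
kernel : Table → ℕ → ℤ
kernel g x = sgn (at false (false ∷ g) (x % 16))

kernel-isKernel : ∀ g → IsKernel (kernel g)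
kernel-isKernel g = record { sign = λ x → sgn-sign (at false (false ∷ g) (x % 16)) ; periodic = λ x → refl }
  where
  sgn-sign : ∀ b → IsSign (sgn b)
  sgn-sign false = inj₁ refl
  sgn-sign true  = inj₂ refl

isOdd : ℕ → Bool
isOdd zero    = false
isOdd (suc n) = not (isOdd n)

sgn-isOdd : ∀ n → sgn (isOdd n) ≡ [-1]^ n
sgn-isOdd zero    = refl
sgn-isOdd (suc n) = trans (flip (isOdd n)) (cong ((ℤ.- 1ᶻ) ℤ.*_) (sgn-isOdd n))
  where
  flip : ∀ b → sgn (not b) ≡ (ℤ.- 1ᶻ) ℤ.* sgn b
  flip false = refl
  flip true  = refl

tableOf : List Word → Table
tableOf A = tab 15 (λ i → isOdd (endings A (suc i)))

kernel-tableOf : ∀ {A} → All NotZeros A → All (λ v → length v ≤ 4) A → ∀ x → kernel (tableOf A) x ≡ [-1]^ (endings A x)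
kernel-tableOf {A} ones A≤4 x = trans (residue (x % 16) (ℕᵈ.m%n<n x 16)) (cong [-1]^_ (endings-%16 A≤4 x))
  where
  endings-0 : ∀ {A} → All NotZeros A → endings A 0 ≡ 0
  endings-0 []           = refl
  endings-0 {v ∷ A} (one ∷ ones) = cong₂ (λ b t → ind b + t) (endsWith-0 (Anyₚ.reverse⁺ one)) (endings-0 ones)
  residue : ∀ r → r < 16 → sgn (at false (false ∷ tableOf A) r) ≡ [-1]^ (endings A r)
  residue zero    _         = sym (cong [-1]^_ (endings-0 ones))
  residue (suc i) (s≤s i<15) = trans (cong sgn (at-tab (λ i → isOdd (endings A (suc i))) i i<15)) (sgn-isOdd (endings A (suc i)))

select : ∀ {A : Set} {n} → Vec Bool n → Vec A n → List A
select []          []       = []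
select (true  ∷ g) (x ∷ xs) = x ∷ select g xs
select (false ∷ g) (x ∷ xs) = select g xs

select-⊆ : ∀ {A : Set} {n} (g : Vec Bool n) (xs : Vec A n) → select g xs ⊆ Vec.toList xs
select-⊆ []          []       = []
select-⊆ (true  ∷ g) (x ∷ xs) = refl ∷ select-⊆ g xs
select-⊆ (false ∷ g) (x ∷ xs) = x ∷ˢ select-⊆ g xs

unique-⊆ : ∀ {A : Set} {xs ys : List A} → xs ⊆ ys → Unique ys → Unique xs
unique-⊆ []          _         = []
unique-⊆ (_ ∷ˢ τ)    (_ ∷ u)   = unique-⊆ τ u
unique-⊆ (refl ∷ τ)  (x≢ ∷ u)  = All-resp-⊆ τ x≢ ∷ unique-⊆ τ u

-- Each nonzero residue modulo 16 is matched by exactly one of these words, so words of length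
-- exactly 4 already realise every table.
words : Vec Word 15
words = tab 15 (λ i → fourDigits (suc i))
  where
  fourDigits : ℕ → Word
  fourDigits x = bit (x / 8) ∷ bit (x / 4) ∷ bit (x / 2) ∷ bit x ∷ []

wordsOf : Table → List Word
wordsOf g = select g words

wordsOf-notZeros : ∀ g → All NotZeros (wordsOf g)
wordsOf-notZeros g = All-resp-⊆ (select-⊆ g words) (from-yes (All.all? (Any.any? (_≟ᶠ suc zero)) (Vec.toList words)))

wordsOf-short : ∀ g → All (λ v → length v ≤ 4) (wordsOf g)
wordsOf-short g = All-resp-⊆ (select-⊆ g words) (from-yes (All.all? (λ v → length v ℕ.≤? 4) (Vec.toList words)))

wordsOf-unique : ∀ g → Unique (wordsOf g)
wordsOf-unique g = unique-⊆ (select-⊆ g words) (from-yes (DecUnique.unique? _≟ʷ_ (Vec.toList words)))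

pairing : ∀ {n} → Vec Bool n → Vec Bool n → ℕ
pairing []      []      = 0
pairing (b ∷ g) (c ∷ h) = ind (b ∧ c) + pairing g h

endings-select : ∀ {n} (g : Vec Bool n) ws x → endings (select g ws) x ≡ pairing g (Vec.map (λ w → endsWith (reverse w) x) ws)
endings-select []          []       x = refl
endings-select (true  ∷ g) (w ∷ ws) x = cong (λ t → ind (endsWith (reverse w) x) + t) (endings-select g ws x)
endings-select (false ∷ g) (w ∷ ws) x = endings-select g ws x

pairing-none : ∀ {n} (g : Vec Bool n) → pairing g (tab n (λ _ → false)) ≡ 0
pairing-none []      = refl
pairing-none (b ∷ g) = cong₂ (λ c t → ind c + t) (∧-zeroʳ b) (pairing-none g)

pairing-one : ∀ {n} (g : Vec Bool n) j → pairing g (tab n (λ i → i ≡ᵇ j)) ≡ ind (at false g j)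
pairing-one []      j       = refl
pairing-one (b ∷ g) zero    = trans (cong₂ (λ c t → ind c + t) (∧-identityʳ b) (pairing-none g)) (ℕₚ.+-identityʳ (ind b))
pairing-one (b ∷ g) (suc j) = cong₂ (λ c t → ind c + t) (∧-zeroʳ b) (pairing-one g j)

kernel-wordsOf : ∀ g x → kernel g x ≡ [-1]^ (endings (wordsOf g) x)
kernel-wordsOf g x = trans (residue (x % 16) (ℕᵈ.m%n<n x 16)) (cong [-1]^_ (endings-%16 (wordsOf-short g) x))
  where
  -- Checked by evaluation: a nonzero residue yields a unit vector, the residue 0 the zero vector.
  -- The pairing with `g` thus reads off a single bit.
  indicator : ∀ {x} → x < 16 → Vec.map (λ w → endsWith (reverse w) x) words ≡ tab 15 (λ i → suc i ≡ᵇ x)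
  indicator = from-yes (ℕₚ.allUpTo? (λ x → Vecₚ.≡-dec Bool._≟_ (Vec.map (λ w → endsWith (reverse w) x) words) (tab 15 (λ i → suc i ≡ᵇ x))) 16)
  endings-wordsOf : ∀ {x} → x < 16 → endings (wordsOf g) x ≡ pairing g (tab 15 (λ i → suc i ≡ᵇ x))
  endings-wordsOf {x} x<16 = trans (endings-select g words x) (cong (pairing g) (indicator x<16))
  sgn-ind : ∀ b → sgn b ≡ [-1]^ (ind b)
  sgn-ind false = refl
  sgn-ind true  = refl
  residue : ∀ r → r < 16 → sgn (at false (false ∷ g) r) ≡ [-1]^ (endings (wordsOf g) r)
  residue zero    r<16 = sym (cong [-1]^_ (trans (endings-wordsOf r<16) (pairing-none g)))
  residue (suc i) r<16 = trans (sgn-ind (at false g i)) (sym (cong [-1]^_ (trans (endings-wordsOf r<16) (pairing-one g i))))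

-- Kernels and sequences determine each other.

generates-resp-≗ : ∀ {G H a b} → (∀ x → G x ≡ H x) → (∀ x → b x ≡ a x) → Generates G a → Generates H b
generates-resp-≗ G≗H b≗a gen = record
  { base = trans (b≗a 0) (Generates.base gen)
  ; step = λ x → trans (b≗a x) (trans (Generates.step gen x) (cong₂ ℤ._*_ (sym (b≗a (x / 2))) (G≗H x)))
  }

generates-functional : ∀ {G a b} → Generates G a → Generates G b → ∀ x → a x ≡ b x
generates-functional {G} {a} {b} ga gb = <-rec _ go
  where
  go : ∀ x → (∀ {y} → y < x → a y ≡ b y) → a x ≡ b x
  go zero    _  = trans (Generates.base ga) (sym (Generates.base gb))
  go (suc x) ih = trans (Generates.step ga (suc x)) (trans (cong (ℤ._* G (suc x)) (ih (s≤s (1+m/2≤m x)))) (sym (Generates.step gb (suc x))))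

-- The values of `a` are signs, so multiplying the recursion by `a (x / 2)` recovers the kernel from
-- the sequence.
kernel-injective : ∀ {g h a} → Generates (kernel g) a → Generates (kernel h) a → g ≡ h
kernel-injective {g} {h} {a} gg gh = at-injective g h λ i i<15 → sgn-injective (subst
    (λ r → sgn (at false (false ∷ g) r) ≡ sgn (at false (false ∷ h) r)) (ℕᵈ.m<n⇒m%n≡m (s≤s i<15)) (same (suc i)))
  where
  open Correlation (kernel-isKernel g) gg using (a-sign)
  cancel : ∀ {s} → IsSign s → ∀ i → s ℤ.* (s ℤ.* i) ≡ i
  cancel {s} σ i = trans (sym (ℤₚ.*-assoc s s i)) (trans (cong (ℤ._* i) (sign²≡1 σ)) (ℤₚ.*-identityˡ i))
  same : ∀ x → kernel g x ≡ kernel h x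
  same x = begin
    kernel g x                                   ≡⟨ cancel (a-sign (x / 2)) (kernel g x) ⟨
    a (x / 2) ℤ.* (a (x / 2) ℤ.* kernel g x)     ≡⟨ cong (a (x / 2) ℤ.*_) (trans (sym (Generates.step gg x)) (Generates.step gh x)) ⟩
    a (x / 2) ℤ.* (a (x / 2) ℤ.* kernel h x)     ≡⟨ cancel (a-sign (x / 2)) (kernel h x) ⟩
    kernel h x                                   ∎
    where open ≡-Reasoning

wordsOf-generated : ∀ g → Generates (kernel g) (patternSeq (wordsOf g))
wordsOf-generated g = generates-resp-≗ (λ x → sym (kernel-wordsOf g x)) (λ _ → refl) (patternSeq-generated (wordsOf-notZeros g))

wordsOf-isBPCS : ∀ g → IsBPCS 4 (patternSeq (wordsOf g))
wordsOf-isBPCS g = wordsOf g , (wordsOf-unique g , wordsOf-notZeros g) , wordsOf-short g , λ _ → refl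

isBPCS-generated : ∀ {a} → IsBPCS 4 a → ∃ λ g → Generates (kernel g) a
isBPCS-generated (A , (_ , ones) , A≤4 , a≗) =
  tableOf A , generates-resp-≗ (λ x → sym (kernel-tableOf ones A≤4 x)) a≗ (patternSeq-generated ones)

-- Enumeration of the tables.

allTables : ∀ n → List (Vec Bool n)
allTables zero    = [] ∷ []
allTables (suc n) = map (false ∷_) (allTables n) ++ map (true ∷_) (allTables n)

∈-allTables : ∀ {n} (g : Vec Bool n) → g ∈ allTables n
∈-allTables []          = here refl
∈-allTables (false ∷ g) = ∈ₚ.∈-++⁺ˡ (∈ₚ.∈-map⁺ (false ∷_) (∈-allTables g))
∈-allTables (true  ∷ g) = ∈ₚ.∈-++⁺ʳ (map (false ∷_) (allTables _)) (∈ₚ.∈-map⁺ (true ∷_) (∈-allTables g))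

allTables-unique : ∀ n → Unique (allTables n)
allTables-unique zero    = [] ∷ []
allTables-unique (suc n) = Uniqueₚ.++⁺ (Uniqueₚ.map⁺ Vecₚ.∷-injectiveʳ (allTables-unique n)) (Uniqueₚ.map⁺ Vecₚ.∷-injectiveʳ (allTables-unique n)) disjoint
  where
  disjoint : ∀ {v} → ¬ (v ∈ map (false ∷_) (allTables n) × v ∈ map (true ∷_) (allTables n))
  disjoint (p , q) with ∈ₚ.∈-map⁻ (false ∷_) p | ∈ₚ.∈-map⁻ (true ∷_) q
  ... | _ , _ , refl | _ , _ , ()

-- Integral profiles and the decision for one table.

Profile : Set
Profile = Vec ℤ 8

_!_ : Profile → ℕ → ℤ
V ! r = at 0ᶻ V r

opaque
  -- The solution V of 2V = fold k 24 V, where 24 is the constant profile of the shift 0.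
  -- The entries are passed through auxiliary functions so that evaluation shares them.
  profile₁ : (k : ℕ → ℤ) → Profile
  profile₁ k = from-e (k 0 ℤ.+ k 8) (k 2 ℤ.+ k 10) (k 4 ℤ.+ k 12) (k 6 ℤ.+ k 14)
    where
    from-v₃ : (e₀ e₂ e₄ e₆ v₁ v₅ v₃ : ℤ) → Profile
    from-v₃ e₀ e₂ e₄ e₆ v₁ v₅ v₃ =
      + 12 ℤ.* e₀ ∷ + 6 ℤ.* v₁ ∷ + 12 ℤ.* e₂ ∷ + 3 ℤ.* v₃ ∷ + 12 ℤ.* e₄ ∷ + 6 ℤ.* v₅ ∷ + 12 ℤ.* e₆ ∷ k 7 ℤ.* v₃ ℤ.* (+ 2 ℤ.+ k 15) ∷ []
    from-v₁-v₅ : (e₀ e₂ e₄ e₆ v₁ v₅ : ℤ) → Profile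
    from-v₁-v₅ e₀ e₂ e₄ e₆ v₁ v₅ = from-v₃ e₀ e₂ e₄ e₆ v₁ v₅ (k 3 ℤ.* v₁ ℤ.+ k 11 ℤ.* v₅)
    from-e : (e₀ e₂ e₄ e₆ : ℤ) → Profile
    from-e e₀ e₂ e₄ e₆ = from-v₁-v₅ e₀ e₂ e₄ e₆ (k 1 ℤ.* e₀ ℤ.+ k 9 ℤ.* e₄) (k 5 ℤ.* e₂ ℤ.+ k 13 ℤ.* e₆)

  -- The system is almost triangular: even entries use only the constant, entry 1 uses 0 and 4,
  -- entry 5 uses 2 and 6, entry 3 uses 1 and 5. Entry 7 uses 3 and itself, so (2 - `k 15`) V(7) =
  -- `k 7` V(3); it is solved by (2 - `k 15`)(2 + `k 15`) = 3.
  profile₁-fixed : ∀ (k : ℕ → ℤ) → k 15 ℤ.* k 15 ≡ 1ᶻ →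
                   ∀ r → r < 8 → + 2 ℤ.* (profile₁ k ! r) ≡ fold k (λ _ → + 24) (profile₁ k !_) r
  profile₁-fixed k k₁₅²≡1 = go
    where
    v₃ : ℤ
    v₃ = k 3 ℤ.* (k 1 ℤ.* (k 0 ℤ.+ k 8) ℤ.+ k 9 ℤ.* (k 4 ℤ.+ k 12)) ℤ.+ k 11 ℤ.* (k 5 ℤ.* (k 2 ℤ.+ k 10) ℤ.+ k 13 ℤ.* (k 6 ℤ.+ k 14))
    from-24 : ∀ a b → + 2 ℤ.* (+ 12 ℤ.* (a ℤ.+ b)) ≡ a ℤ.* + 24 ℤ.+ b ℤ.* + 24
    from-24 = ℤ-Solver.solve-∀
    from-12 : ∀ a b x y → + 2 ℤ.* (+ 6 ℤ.* (a ℤ.* x ℤ.+ b ℤ.* y)) ≡ a ℤ.* (+ 12 ℤ.* x) ℤ.+ b ℤ.* (+ 12 ℤ.* y)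
    from-12 = ℤ-Solver.solve-∀
    from-6 : ∀ a b x y → + 2 ℤ.* (+ 3 ℤ.* (a ℤ.* x ℤ.+ b ℤ.* y)) ≡ a ℤ.* (+ 6 ℤ.* x) ℤ.+ b ℤ.* (+ 6 ℤ.* y)
    from-6 = ℤ-Solver.solve-∀
    expand : ∀ a b v → + 2 ℤ.* (a ℤ.* v ℤ.* (+ 2 ℤ.+ b)) ≡ a ℤ.* v ℤ.* + 3 ℤ.+ a ℤ.* v ℤ.* + 1 ℤ.+ + 2 ℤ.* (b ℤ.* (a ℤ.* v))
    expand = ℤ-Solver.solve-∀
    gather : ∀ a b v → a ℤ.* v ℤ.* + 3 ℤ.+ a ℤ.* v ℤ.* (b ℤ.* b) ℤ.+ + 2 ℤ.* (b ℤ.* (a ℤ.* v)) ≡ a ℤ.* (+ 3 ℤ.* v) ℤ.+ b ℤ.* (a ℤ.* v ℤ.* (+ 2 ℤ.+ b))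
    gather = ℤ-Solver.solve-∀
    go : ∀ r → r < 8 → + 2 ℤ.* (profile₁ k ! r) ≡ fold k (λ _ → + 24) (profile₁ k !_) r
    go 0 _ = from-24 (k 0) (k 8)
    go 1 _ = from-12 (k 1) (k 9) (k 0 ℤ.+ k 8) (k 4 ℤ.+ k 12)
    go 2 _ = from-24 (k 2) (k 10)
    go 3 _ = from-6 (k 3) (k 11) (k 1 ℤ.* (k 0 ℤ.+ k 8) ℤ.+ k 9 ℤ.* (k 4 ℤ.+ k 12)) (k 5 ℤ.* (k 2 ℤ.+ k 10) ℤ.+ k 13 ℤ.* (k 6 ℤ.+ k 14))
    go 4 _ = from-24 (k 4) (k 12)
    go 5 _ = from-12 (k 5) (k 13) (k 2 ℤ.+ k 10) (k 6 ℤ.+ k 14)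
    go 6 _ = from-24 (k 6) (k 14)
    -- The hypothesis on `k 15` is used only in the middle, to replace the factor 1 split off by
    -- `expand`; the outer two steps are ring identities.
    go 7 _ = trans (expand (k 7) (k 15) v₃)
                   (trans (cong (λ t → k 7 ℤ.* v₃ ℤ.* + 3 ℤ.+ k 7 ℤ.* v₃ ℤ.* t ℤ.+ + 2 ℤ.* (k 15 ℤ.* (k 7 ℤ.* v₃))) (sym k₁₅²≡1)) (gather (k 7) (k 15) v₃))
    go (suc (suc (suc (suc (suc (suc (suc (suc r)))))))) (s≤s (s≤s (s≤s (s≤s (s≤s (s≤s (s≤s (s≤s ()))))))))

opaque
  double : Profile → Profile
  double V = tab 8 (λ r → + 2 ℤ.* (V ! r))

  double-! : ∀ V r → r < 8 → double V ! r ≡ + 2 ℤ.* (V ! r)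
  double-! V = at-tab (λ r → + 2 ℤ.* (V ! r))

  foldProfile : (G : ℕ → ℤ) (m : ℕ) (X Y : Profile) → Profile
  foldProfile G m X Y = tab 8 (fold (κ G m) (X !_) (Y !_))

  foldProfile-! : ∀ G m X Y r → r < 8 → foldProfile G m X Y ! r ≡ fold (κ G m) (X !_) (Y !_) r
  foldProfile-! G m X Y = at-tab (fold (κ G m) (X !_) (Y !_))

-- `undecided` means that the shifts 1 to 4 reveal no correlation while the sufficient criterion for
-- larger shifts fails.
data Verdict : Set where
  correlated noncorrelated undecided : Verdict

Balanced Null : Profile → Set
Balanced V = ∑ 8 (V !_) ≡ 0ᶻ
Null V = ∀ {r} → r < 8 → V ! r ≡ 0ᶻ

balanced? : ∀ V → Dec (Balanced V)
balanced? V = ∑ 8 (V !_) ℤ.≟ 0ᶻ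

null? : ∀ V → Dec (Null V)
null? V = ℕₚ.allUpTo? (λ r → V ! r ℤ.≟ 0ᶻ) 8

opaque
  judge : (V₁ V₂ V₃ V₄ V₅ V₆ V₇ : Profile) → Verdict
  judge V₁ V₂ V₃ V₄ V₅ V₆ V₇ with balanced? V₁ ×-dec balanced? V₂ ×-dec balanced? V₃ ×-dec balanced? V₄
  ... | no _  = correlated
  ... | yes _ with null? V₄ ×-dec null? V₅ ×-dec null? V₆ ×-dec null? V₇
  ...   | no _  = undecided
  ...   | yes _ = noncorrelated

  judge-noncorrelated : ∀ V₁ V₂ V₃ V₄ V₅ V₆ V₇ → judge V₁ V₂ V₃ V₄ V₅ V₆ V₇ ≡ noncorrelated →
    (Balanced V₁ × Balanced V₂ × Balanced V₃ × Balanced V₄) × (Null V₄ × Null V₅ × Null V₆ × Null V₇)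
  judge-noncorrelated V₁ V₂ V₃ V₄ V₅ V₆ V₇ e with balanced? V₁ ×-dec balanced? V₂ ×-dec balanced? V₃ ×-dec balanced? V₄
  judge-noncorrelated V₁ V₂ V₃ V₄ V₅ V₆ V₇ () | no _
  ... | yes b with null? V₄ ×-dec null? V₅ ×-dec null? V₆ ×-dec null? V₇
  judge-noncorrelated V₁ V₂ V₃ V₄ V₅ V₆ V₇ () | yes b | no _
  judge-noncorrelated V₁ V₂ V₃ V₄ V₅ V₆ V₇ _  | yes b | yes n = b , n

  judge-correlated : ∀ V₁ V₂ V₃ V₄ V₅ V₆ V₇ → judge V₁ V₂ V₃ V₄ V₅ V₆ V₇ ≡ correlated →
    ¬ (Balanced V₁ × Balanced V₂ × Balanced V₃ × Balanced V₄)
  judge-correlated V₁ V₂ V₃ V₄ V₅ V₆ V₇ e with balanced? V₁ ×-dec balanced? V₂ ×-dec balanced? V₃ ×-dec balanced? V₄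
  ... | no ¬b = ¬b
  ... | yes b with null? V₄ ×-dec null? V₅ ×-dec null? V₆ ×-dec null? V₇
  judge-correlated V₁ V₂ V₃ V₄ V₅ V₆ V₇ () | yes b | yes _
  judge-correlated V₁ V₂ V₃ V₄ V₅ V₆ V₇ () | yes b | no _

-- Folding doubles the scale D of Density; where the two profiles have different scales, double adjusts the first one.
module _ (G : ℕ → ℤ) where
  judge₄ : (V₁ V₂ V₃ V₄ : Profile) → Verdict
  judge₄ V₁ V₂ V₃ V₄ = judge V₁ V₂ V₃ V₄ (foldProfile G 5 (double V₂) V₃) (foldProfile G 6 V₃ V₃) (foldProfile G 7 V₃ V₄)

  judge₃ : (V₁ V₂ V₃ : Profile) → Verdict
  judge₃ V₁ V₂ V₃ = judge₄ V₁ V₂ V₃ (foldProfile G 4 V₂ V₂)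

  judge₂ : (V₁ V₂ : Profile) → Verdict
  judge₂ V₁ V₂ = judge₃ V₁ V₂ (foldProfile G 3 (double V₁) V₂)

  judge₁ : (V₁ : Profile) → Verdict
  judge₁ V₁ = judge₂ V₁ (foldProfile G 2 V₁ V₁)

-- Tabulating κ makes evaluation compute each of its values once.
verdict : Table → Verdict
verdict g = judge₁ (kernel g) (profile₁ (at 0ᶻ (tab 16 (κ (kernel g) 1))))

-- Counting with verdicts.

module _ {A : Set} (f : A → Verdict) where
  noncorrelated? : ∀ x → Dec (f x ≡ noncorrelated)
  noncorrelated? x with f x
  ... | correlated    = no λ ()
  ... | noncorrelated = yes refl
  ... | undecided     = no λ ()

  tally : Verdict → Maybe ℕ → Maybe ℕ
  tally correlated    n = n
  tally noncorrelated n = Maybe.map suc n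
  tally undecided     n = nothing

  census : List A → Maybe ℕ
  census = foldr (tally ∘ f) (just 0)

  -- `nothing` is absorbing in `tally`, so a result `just n` excludes `undecided` for every element.
  census-sound : ∀ xs {n} → census xs ≡ just n → length (filter noncorrelated? xs) ≡ n × All (λ x → f x ≢ undecided) xs
  census-sound []       refl = refl , []
  census-sound (x ∷ xs) e with f x in fx
  census-sound (x ∷ xs) e | correlated with census-sound xs e
  ... | l , all = l , (λ u → contradiction (trans (sym fx) u) λ ()) ∷ all
  census-sound (x ∷ xs) e | noncorrelated with census xs in c
  census-sound (x ∷ xs) refl | noncorrelated | just n with census-sound xs c
  ... | l , all = cong suc l , (λ u → contradiction (trans (sym fx) u) λ ()) ∷ all

-- Soundness of the verdict.

module _ {g : Table} {a : ℕ → ℤ} (generates : Generates (kernel g) a) where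
  open Correlation (kernel-isKernel g) generates

  private
    G k′ : ℕ → ℤ
    G = kernel g
    k′ = at 0ᶻ (tab 16 (κ G 1))

    P₁ P₂ P₃ P₄ P₅ P₆ P₇ : Profile
    P₁ = profile₁ k′
    P₂ = foldProfile G 2 P₁ P₁
    P₃ = foldProfile G 3 (double P₁) P₂
    P₄ = foldProfile G 4 P₂ P₂
    P₅ = foldProfile G 5 (double P₂) P₃
    P₆ = foldProfile G 6 P₃ P₃
    P₇ = foldProfile G 7 P₃ P₄

    density-foldProfile : ∀ {D m lo hi} X Y → Splits m lo hi → Density D (X !_) lo → Density D (Y !_) hi →
                          Density (2 * D) (foldProfile G m X Y !_) m
    density-foldProfile {D} {m} X Y splits dX dY = density-cong {2 * D} {fold (k m) (X !_) (Y !_)}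
      (λ r r<8 → sym (foldProfile-! G m X Y r r<8)) (density-fold splits dX dY)

    density-doubleProfile : ∀ {D m} X → Density D (X !_) m → Density (2 * D) (double X !_) m
    density-doubleProfile {D} X dX = density-cong {2 * D} {λ r → + 2 ℤ.* (X ! r)}
      (λ r r<8 → sym (double-! X r r<8)) (density-double dX)

    -- The shift 1 splits into 0 and itself. Averaging over a period divides by 8, so the constant
    -- profile 24 belongs to the scale 8 · 24 = 192.
    density₁ : Density 192 (P₁ !_) 1
    density₁ = density-self {192} {1} {0} {λ _ → + 24} {P₁ !_} (splits-odd 0) fixed (E₀-bounded 24)
      where
      k′≡ : ∀ r → r < 16 → k′ r ≡ κ G 1 r
      k′≡ = at-tab (κ G 1)
      fixed : ∀ r → r < 8 → + 2 ℤ.* (P₁ ! r) ≡ fold (κ G 1) (λ _ → + 24) (P₁ !_) r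
      fixed r r<8 = trans (profile₁-fixed k′ (sign²≡1 (κ-sign 1 15)) r r<8)
        (cong₂ (λ s t → s ℤ.* interleave (λ _ → + 24) (P₁ !_) r ℤ.+ t ℤ.* interleave (λ _ → + 24) (P₁ !_) (8 + r))
          (k′≡ r (ℕₚ.<-≤-trans r<8 (ℕₚ.m≤m+n 8 8))) (k′≡ (8 + r) (ℕₚ.+-monoʳ-< 8 r<8)))

    density₂ : Density 384 (P₂ !_) 2
    density₂ = density-foldProfile P₁ P₁ (splits-even 1) density₁ density₁

    density₃ : Density 768 (P₃ !_) 3
    density₃ = density-foldProfile (double P₁) P₂ (splits-odd 1) (density-doubleProfile P₁ density₁) density₂

    density₄ : Density 768 (P₄ !_) 4
    density₄ = density-foldProfile P₂ P₂ (splits-even 2) density₂ density₂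

    density₅ : Density 1536 (P₅ !_) 5
    density₅ = density-foldProfile (double P₂) P₃ (splits-odd 2) (density-doubleProfile P₂ density₂) density₃

    density₆ : Density 1536 (P₆ !_) 6
    density₆ = density-foldProfile P₃ P₃ (splits-even 3) density₃ density₃

    density₇ : Density 1536 (P₇ !_) 7
    density₇ = density-foldProfile P₃ P₄ (splits-odd 3) density₃ density₄

  module _ {V₁ V₂ V₃ V₄ V₅ V₆ V₇ : Profile}
    (d₁ : Density 192 (V₁ !_) 1) (d₂ : Density 384 (V₂ !_) 2) (d₃ : Density 768 (V₃ !_) 3) (d₄ : Density 768 (V₄ !_) 4)
    (d₅ : Density 1536 (V₅ !_) 5) (d₆ : Density 1536 (V₆ !_) 6) (d₇ : Density 1536 (V₇ !_) 7) where

    judge-noncorrelated-sound : judge V₁ V₂ V₃ V₄ V₅ V₆ V₇ ≡ noncorrelated → Noncorrelated a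
    judge-noncorrelated-sound e m 1≤m with judge-noncorrelated V₁ V₂ V₃ V₄ V₅ V₆ V₇ e
    ... | (b₁ , b₂ , b₃ , _) , (n₄ , n₅ , n₆ , n₇) = go m 1≤m
      where
      base : ∀ m → m < 4 → Vanishes (4 + m)
      base 0 _ = density-zero d₄ (λ _ → n₄)
      base 1 _ = density-zero d₅ (λ _ → n₅)
      base 2 _ = density-zero d₆ (λ _ → n₆)
      base 3 _ = density-zero d₇ (λ _ → n₇)
      base (suc (suc (suc (suc _)))) (s≤s (s≤s (s≤s (s≤s ()))))
      go : ∀ m → 1 ≤ m → CorrToZero a m
      go 1 _ = sum≡0⇒corrToZero d₁ b₁
      go 2 _ = sum≡0⇒corrToZero d₂ b₂
      go 3 _ = sum≡0⇒corrToZero d₃ b₃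
      go m@(suc (suc (suc (suc _)))) _ = sum≡0⇒corrToZero (vanishes-4+ base m (s≤s (s≤s (s≤s (s≤s z≤n))))) refl

    judge-correlated-sound : judge V₁ V₂ V₃ V₄ V₅ V₆ V₇ ≡ correlated → ¬ Noncorrelated a
    judge-correlated-sound e nc = judge-correlated V₁ V₂ V₃ V₄ V₅ V₆ V₇ e
      ( corrToZero⇒sum≡0 d₁ (nc 1 (s≤s z≤n))
      , corrToZero⇒sum≡0 d₂ (nc 2 (s≤s z≤n))
      , corrToZero⇒sum≡0 d₃ (nc 3 (s≤s z≤n))
      , corrToZero⇒sum≡0 d₄ (nc 4 (s≤s z≤n)) )

  noncorrelated-sound : verdict g ≡ noncorrelated → Noncorrelated a
  noncorrelated-sound = judge-noncorrelated-sound density₁ density₂ density₃ density₄ density₅ density₆ density₇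

  correlated-sound : verdict g ≡ correlated → ¬ Noncorrelated a
  correlated-sound = judge-correlated-sound density₁ density₂ density₃ density₄ density₅ density₆ density₇

-- Classification of the noncorrelated sequences.

sequence : Table → ℕ → ℤ
sequence g = patternSeq (wordsOf g)

sequence-injective : ∀ {g h} → sequence g ≗ˢ sequence h → g ≡ h
sequence-injective {g} {h} e = kernel-injective (wordsOf-generated g)
  (generates-resp-≗ (λ _ → refl) e (wordsOf-generated h))

module Counting (gs : List Table) (∈-gs : ∀ g → g ∈ gs) (gs-unique : Unique gs)
                {N : ℕ} (census≡ : census verdict gs ≡ just N) where
  tables : List Table
  tables = filter (noncorrelated? verdict) gs

  private
    sound : length tables ≡ N × All (λ g → verdict g ≢ undecided) gs
    sound = census-sound verdict gs census≡

  decided : ∀ g → verdict g ≢ undecided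
  decided g = All.lookup (proj₂ sound) (∈-gs g)

  -- The null test is only a sufficient criterion; the converse follows by exclusion, since the
  -- census leaves no table undecided.
  noncorrelated-complete : ∀ {g a} → Generates (kernel g) a → Noncorrelated a → verdict g ≡ noncorrelated
  noncorrelated-complete {g} gen nc with verdict g in e
  ... | correlated    = contradiction nc (correlated-sound gen e)
  ... | noncorrelated = refl
  ... | undecided     = contradiction e (decided g)

  classification : Σ (List (ℕ → ℤ)) λ L →
    length L ≡ N
    × AllPairs (λ f g → ¬ (f ≗ˢ g)) L
    × All (λ a → IsBPCS 4 a × Noncorrelated a) L
    × (∀ (a : ℕ → ℤ) → IsBPCS 4 a → Noncorrelated a → Any (λ b → a ≗ˢ b) L)
  classification = map sequence tables
    , trans (Listₚ.length-map sequence tables) (proj₁ sound)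
    , AllPairsₚ.map⁺ (AllPairs.map (λ g≢h e → g≢h (sequence-injective e)) (Uniqueₚ.filter⁺ (noncorrelated? verdict) gs-unique))
    , Allₚ.map⁺ (All.map (λ {g} e → wordsOf-isBPCS g , noncorrelated-sound (wordsOf-generated g) e) (Allₚ.all-filter (noncorrelated? verdict) gs))
    , λ a isBPCS nc → covered a (isBPCS-generated isBPCS) nc
    where
    covered : ∀ a → (∃ λ g → Generates (kernel g) a) → Noncorrelated a → Any (λ b → a ≗ˢ b) (map sequence tables)
    covered a (g , gen) nc = Anyₚ.map⁺ (Any.map (λ { refl → generates-functional gen (wordsOf-generated g) })
      (∈ₚ.∈-filter⁺ (noncorrelated? verdict) (∈-gs g) (noncorrelated-complete gen nc)))

opaque
  unfolding profile₁ double foldProfile judge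

  -- Evaluation of the verdict on all tables, the one place where profiles are unfolded; elsewhere
  -- they are atoms. Besides the count, the constructor `just` certifies that no table is undecided.
  census-allTables : census verdict (allTables 15) ≡ just 2272
  census-allTables = refl

theoremA : Σ (List (ℕ → ℤ)) λ L →
    length L ≡ 2272
    × AllPairs (λ f g → ¬ (f ≗ˢ g)) L
    × All (λ a → IsBPCS 4 a × Noncorrelated a) L
    × (∀ (a : ℕ → ℤ) → IsBPCS 4 a → Noncorrelated a → Any (λ b → a ≗ˢ b) L)
theoremA = Counting.classification (allTables 15) ∈-allTables (allTables-unique 15) census-allTables
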